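{- Each of the following decision problems can be solved in time polynomial in the size of the input: given two TRSs $R_1,R_2$, decide whether $R_1\cong_{\mathbf{LE}}R_2$; whether $R_1\cong_{\mathbf{LVE}}R_2$; whether $R_1\cong_{\mathbf{LFE}}R_2$.
   Context: Terms and TRSs: $\mathcal{F}$ is a finite set of function symbols with arity map $\mathrm{ar}:\mathcal{F}\to\mathbb{N}_0$, $\mathcal{V}$ a finite set of variables disjoint from $\mathcal{F}$, and $T(\mathcal{F},\mathcal{V})$ the usual set of first-order terms over them. A term rewriting system (TRS) is a triple $R=(\mathcal{F},\mathcal{V},\mathcal{R})$ where $\mathcal{R}$ is a finite set of rules $\ell\to r$ with $\ell,r\in T(\mathcal{F},\mathcal{V})$, $\ell\notin\mathcal{V}$ and every variable of $r$ occurs in $\ell$; $\mathcal{F}$ and $\mathcal{V}$ contain all symbols occurring in the rules. Term isomorphisms: a term isomorphism $\phi:T(\mathcal{F},\mathcal{V})\to T(\mathcal{F}',\mathcal{V}')$ is a pair of bijections $\phi_{\mathcal{F}}:\mathcal{F}\to\mathcal{F}'$ with $\mathrm{ar}'(\phi_{\mathcal{F}}(f))=\mathrm{ar}(f)$ for all $f$, and $\phi_{\mathcal{V}}:\mathcal{V}\to\mathcal{V}'$, extended homomorphically to terms. It is $\mathcal{V}$-invariant if $\mathcal{V}=\mathcal{V}'$ and $\phi_{\mathcal{V}}=\mathrm{id}$, and $\mathcal{F}$-invariant if $\mathcal{F}=\mathcal{F}'$ (with equal arities) and $\phi_{\mathcal{F}}=\mathrm{id}$. Normal forms: two distinct rules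 $\ell\to r$, $\ell'\to r'$ of $\mathcal{R}$ are equivalent (resp. $\mathcal{V}$-equivalent, resp. $\mathcal{F}$-equivalent) if there is a term isomorphism (resp. an $\mathcal{F}$-invariant one, resp. a $\mathcal{V}$-invariant one) $\phi:T(\mathcal{F},\mathcal{V})\to T(\mathcal{F},\mathcal{V})$ with $\phi(\ell)=\ell'$ and $\phi(r)=r'$. $R$ is in normal form (resp. $\mathcal{V}$-normal form, resp. $\mathcal{F}$-normal form) if $\mathcal{R}$ contains no pair of equivalent (resp. $\mathcal{V}$-equivalent, resp. $\mathcal{F}$-equivalent) rules. Local TRS isomorphisms: for $R=(\mathcal{F},\mathcal{V},\mathcal{R})$ with $\mathcal{R}=\{\ell_1\to r_1,\dots,\ell_n\to r_n\}$ and $R'=(\mathcal{F}',\mathcal{V}',\mathcal{R}')$, a local isomorphism is a family $(\phi_1,\dots,\phi_n)$ of term isomorphisms $T(\mathcal{F},\mathcal{V})\to T(\mathcal{F}',\mathcal{V}')$ with $\{\phi_i(\ell_i)\to\phi_i(r_i):1\le i\le n\}=\mathcal{R}'$. $R\cong_{\mathbf{LE}}R'$ if both are in normal form and a local isomorphism exists; $R\cong_{\mathbf{LVE}}R'$ if both are in $\mathcal{V}$-normal form and there is a local isomorphism all of whose $\phi_i$ are $\mathcal{F}$-invariant; $R\cong_{\mathbf{LFE}}R'$ if both are in $\mathcal{F}$-normal form and there is a local isomorphism all of whose $\phi_i$ are $\mathcal{V}$-invariant. -}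

module Defs where

open import Data.Bool.Base using (Bool; true; false)
open import Data.Fin.Base using (Fin)
open import Data.List.Base as List using (List; []; _∷_; length)
open import Data.List.Membership.Propositional using (_∈_)
open import Data.List.Relation.Unary.All using (All)
open import Data.List.Relation.Unary.Unique.Propositional using (Unique)
open import Data.Nat.Base using (ℕ; suc; _+_; _*_; _^_; _≤_)
open import Data.Nat.Binary.Base using (ℕᵇ; 2[1+_]; 1+[2_]; fromℕ)
open import Data.Product.Base using (Σ-syntax; ∃-syntax; _×_; _,_)
open import Data.Unit.Base using (⊤)
open import Data.Vec.Base as Vec using (Vec; []; _∷_)
open import Data.Vec.Relation.Unary.Any using (Any)
open import Function.Bundles using (_⇔_; _⤖_; module Bijection)
open import Function.Definitions using (Injective)
open import Relation.Binary.PropositionalEquality using (_≡_; _≢_; sym)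
open import Relation.Nullary.Negation using (¬_)

------------------------------------------------------------------------
-- Terms and term rewriting systems

-- A finite set of symbols, enumerated without repetition.  A symbol is
-- an element of `Fin card`; its name says which symbol it is when two
-- different sets are compared.
record FiniteSet : Set where
  field
    card           : ℕ
    name           : Fin card → ℕ
    name-injective : Injective _≡_ _≡_ name

open FiniteSet public

Element : FiniteSet → Set
Element X = Fin (card X)

-- The pair (𝓕 , 𝓥) with the arity map.  𝓕 and 𝓥 are disjoint because
-- they are used through different constructors of `Term`.
record Signature : Set where
  field
    𝓕  : FiniteSet
    𝓥  : FiniteSet
    ar : Element 𝓕 → ℕ

open Signature public

data Term (S : Signature) : Set where
  var : Element (𝓥 S) → Term S
  app : (f : Element (𝓕 S)) → Vec (Term S) (ar S f) → Term S

data _occursIn_ {S : Signature} (x : Element (𝓥 S)) : Term S → Set where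
  here  : x occursIn var x
  there : ∀ {f ts} → Any (x occursIn_) ts → x occursIn app f ts

TermPair : Signature → Set
TermPair S = Term S × Term S

IsRule : ∀ {S} → TermPair S → Set
IsRule (ℓ , r) = (∀ x → ℓ ≢ var x) × (∀ x → x occursIn r → x occursIn ℓ)

record TRS : Set where
  field
    signature    : Signature
    rules        : List (TermPair signature)
    rules-unique : Unique rules
    rules-wf     : All IsRule rules

open TRS public

------------------------------------------------------------------------
-- Term isomorphisms

record TermIso (S S′ : Signature) : Set where
  field
    φ𝓕    : Element (𝓕 S) ⤖ Element (𝓕 S′)
    φ𝓥    : Element (𝓥 S) ⤖ Element (𝓥 S′)
    ar-φ𝓕 : ∀ f → ar S′ (Bijection.to φ𝓕 f) ≡ ar S f

open TermIso public

module _ {S S′ : Signature} (φ : TermIso S S′) where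

  mutual
    mapTerm : Term S → Term S′
    mapTerm (var x)    = var (Bijection.to (φ𝓥 φ) x)
    mapTerm (app f ts) =
      app (Bijection.to (φ𝓕 φ) f) (Vec.cast (sym (ar-φ𝓕 φ f)) (mapTerms ts))

    mapTerms : ∀ {n} → Vec (Term S) n → Vec (Term S′) n
    mapTerms []       = []
    mapTerms (t ∷ ts) = mapTerm t ∷ mapTerms ts

  mapPair : TermPair S → TermPair S′
  mapPair (ℓ , r) = mapTerm ℓ , mapTerm r

IsoClass : Set₁
IsoClass = ∀ {S S′} → TermIso S S′ → Set

AnyIso : IsoClass
AnyIso _ = ⊤

-- A bijection preserving names exists only between sets having the same
-- names, and is then the identity: this is "𝓕 = 𝓕′ and φ𝓕 = id".
-- Equality of the two arity maps is `ar-φ𝓕`.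
𝓕-Invariant : IsoClass
𝓕-Invariant {S} {S′} φ =
  ∀ f → name (𝓕 S′) (Bijection.to (φ𝓕 φ) f) ≡ name (𝓕 S) f

𝓥-Invariant : IsoClass
𝓥-Invariant {S} {S′} φ =
  ∀ x → name (𝓥 S′) (Bijection.to (φ𝓥 φ) x) ≡ name (𝓥 S) x

------------------------------------------------------------------------
-- Normal forms and local isomorphisms, relative to a class of term
-- isomorphisms

EquivalentRules : IsoClass → ∀ {S} → TermPair S → TermPair S → Set
EquivalentRules C {S} ρ ρ′ = Σ[ φ ∈ TermIso S S ] C φ × mapPair φ ρ ≡ ρ′

NormalFormFor : IsoClass → TRS → Set
NormalFormFor C R = ∀ {ρ ρ′} → ρ ∈ rules R → ρ′ ∈ rules R → ρ ≢ ρ′ →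
                    ¬ EquivalentRules C ρ ρ′

LocalIso : IsoClass → TRS → TRS → Set
LocalIso C R R′ =
  Σ[ φ ∈ (Fin (length (rules R)) → TermIso (signature R) (signature R′)) ]
    (∀ i → C (φ i)) ×
    (∀ ρ′ → (∃[ i ] mapPair (φ i) (List.lookup (rules R) i) ≡ ρ′) ⇔ ρ′ ∈ rules R′)

NormalForm 𝓥-NormalForm 𝓕-NormalForm : TRS → Set
NormalForm   = NormalFormFor AnyIso
𝓥-NormalForm = NormalFormFor 𝓕-Invariant
𝓕-NormalForm = NormalFormFor 𝓥-Invariant

infix 4 _≅LE_ _≅LVE_ _≅LFE_

_≅LE_ _≅LVE_ _≅LFE_ : TRS → TRS → Set
R ≅LE  R′ = NormalForm R   × NormalForm R′   × LocalIso AnyIso R R′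
R ≅LVE R′ = 𝓥-NormalForm R × 𝓥-NormalForm R′ × LocalIso 𝓕-Invariant R R′
R ≅LFE R′ = 𝓕-NormalForm R × 𝓕-NormalForm R′ × LocalIso 𝓥-Invariant R R′

------------------------------------------------------------------------
-- Model of computation: first-order call-by-value functional programs
-- over binary trees ("pure Lisp"), with unit-cost evaluation steps.
--
-- The only constants are leaves and the only test is the constructor
-- test, so a program inspects its input one constructor at a time.
-- With trees stored as shared pointers, t evaluation steps are O(t)
-- pointer operations on a heap growing by at most one cell per step.
-- Hence polynomial time here is polynomial time on Turing machines; see
-- N. D. Jones, "Computability and Complexity from a Programming
-- Perspective" (1997), for this tree model, and Avanzini & Moser,
-- "Closing the Gap Between Runtime Complexity and Polytime
-- Computability" (RTA 2010), for unit-cost innermost evaluation.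

data Tree : Set where
  leaf : Tree
  node : Tree → Tree → Tree

size : Tree → ℕ
size leaf       = 1
size (node l r) = suc (size l + size r)

-- Expressions in n variables, calling functions of the given arities.
data Expr {k : ℕ} (arity : Fin k → ℕ) (n : ℕ) : Set where
  var  : Fin n → Expr arity n
  leaf : Expr arity n
  node : Expr arity n → Expr arity n → Expr arity n
  -- case e e₁ e₂: if e is a leaf then e₁, otherwise e₂ with the left
  -- subtree of e as variable 0 and the right subtree as variable 1
  case : Expr arity n → Expr arity n → Expr arity (2 + n) → Expr arity n
  call : (f : Fin k) → Vec (Expr arity n) (arity f) → Expr arity n

record Program : Set where
  field
    functions : ℕ
    arity     : Fin functions → ℕ
    body      : (f : Fin functions) → Expr arity (arity f)
    main      : Expr arity 1

module Evaluation (P : Program) where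
  open Program P

  infix 4 _⊢_⇓_⟨_⟩ _⊢_⇓*_⟨_⟩

  -- ρ ⊢ e ⇓ v ⟨ t ⟩: in environment ρ, e evaluates to v in t steps.
  -- Evaluation is deterministic: exactly one rule applies to each
  -- expression, given the value of the scrutinee of `case`.
  mutual
    data _⊢_⇓_⟨_⟩ {n} (ρ : Vec Tree n) : Expr arity n → Tree → ℕ → Set where
      var : ∀ {i} → ρ ⊢ var i ⇓ Vec.lookup ρ i ⟨ 1 ⟩

      leaf : ρ ⊢ leaf ⇓ leaf ⟨ 1 ⟩

      node : ∀ {e₁ e₂ v₁ v₂ t₁ t₂} →
             ρ ⊢ e₁ ⇓ v₁ ⟨ t₁ ⟩ → ρ ⊢ e₂ ⇓ v₂ ⟨ t₂ ⟩ →
             ρ ⊢ node e₁ e₂ ⇓ node v₁ v₂ ⟨ suc (t₁ + t₂) ⟩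

      case-leaf : ∀ {e e₁ e₂ v t₁ t₂} →
                  ρ ⊢ e ⇓ leaf ⟨ t₁ ⟩ → ρ ⊢ e₁ ⇓ v ⟨ t₂ ⟩ →
                  ρ ⊢ case e e₁ e₂ ⇓ v ⟨ suc (t₁ + t₂) ⟩

      case-node : ∀ {e e₁ e₂ l r v t₁ t₂} →
                  ρ ⊢ e ⇓ node l r ⟨ t₁ ⟩ → (l ∷ r ∷ ρ) ⊢ e₂ ⇓ v ⟨ t₂ ⟩ →
                  ρ ⊢ case e e₁ e₂ ⇓ v ⟨ suc (t₁ + t₂) ⟩

      call : ∀ {f es vs v t₁ t₂} →
             ρ ⊢ es ⇓* vs ⟨ t₁ ⟩ → vs ⊢ body f ⇓ v ⟨ t₂ ⟩ →
             ρ ⊢ call f es ⇓ v ⟨ suc (t₁ + t₂) ⟩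

    data _⊢_⇓*_⟨_⟩ {n} (ρ : Vec Tree n) :
         ∀ {m} → Vec (Expr arity n) m → Vec Tree m → ℕ → Set where
      []  : ρ ⊢ [] ⇓* [] ⟨ 0 ⟩

      _∷_ : ∀ {m e v t₁ t₂} {es : Vec (Expr arity n) m} {vs} →
            ρ ⊢ e ⇓ v ⟨ t₁ ⟩ → ρ ⊢ es ⇓* vs ⟨ t₂ ⟩ →
            ρ ⊢ e ∷ es ⇓* v ∷ vs ⟨ t₁ + t₂ ⟩

_on_outputs_in-time_ : Program → Tree → Tree → ℕ → Set
P on input outputs v in-time t = (input ∷ []) ⊢ Program.main P ⇓ v ⟨ t ⟩
  where open Evaluation P

------------------------------------------------------------------------
-- Encodings of data as trees

encodeBool : Bool → Tree
encodeBool false = leaf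
encodeBool true  = node leaf leaf

encodeList : List Tree → Tree
encodeList []       = leaf
encodeList (x ∷ xs) = node x (encodeList xs)

-- The list of bijective base-2 digits, least significant digit first;
-- its length is logarithmic in the number.
encodeℕᵇ : ℕᵇ → Tree
encodeℕᵇ ℕᵇ.zero  = leaf
encodeℕᵇ 2[1+ n ] = node leaf (encodeℕᵇ n)
encodeℕᵇ 1+[2 n ] = node (node leaf leaf) (encodeℕᵇ n)

encodeℕ : ℕ → Tree
encodeℕ n = encodeℕᵇ (fromℕ n)

mutual
  encodeTerm : ∀ {S} → Term S → Tree
  encodeTerm {S} (var x)    = node leaf (encodeℕ (name (𝓥 S) x))
  encodeTerm {S} (app f ts) =
    node (node leaf leaf) (node (encodeℕ (name (𝓕 S) f)) (encodeTerms ts))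

  encodeTerms : ∀ {S n} → Vec (Term S) n → Tree
  encodeTerms []       = leaf
  encodeTerms (t ∷ ts) = node (encodeTerm t) (encodeTerms ts)

encodePair : ∀ {S} → TermPair S → Tree
encodePair (ℓ , r) = node (encodeTerm ℓ) (encodeTerm r)

encodeTRS : TRS → Tree
encodeTRS R = node functionSymbols (node variables ruleList)
  where
  S = signature R
  functionSymbols = encodeList (List.tabulate λ f →
    node (encodeℕ (name (𝓕 S) f)) (encodeℕ (ar S f)))
  variables = encodeList (List.tabulate λ x → encodeℕ (name (𝓥 S) x))
  ruleList  = encodeList (List.map encodePair (rules R))

encodeTRS² : TRS × TRS → Tree
encodeTRS² (R₁ , R₂) = node (encodeTRS R₁) (encodeTRS R₂)

------------------------------------------------------------------------
-- Decidability in polynomial time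

-- The bound c · sizeᵈ + c dominates every polynomial for suitable c, d.
PolyTimeDecidable : {A : Set} → (A → Tree) → (A → Set) → Set
PolyTimeDecidable {A} encode Q =
  Σ[ P ∈ Program ] ∃[ c ] ∃[ d ] ∀ (a : A) → ∃[ b ] ∃[ t ]
    P on encode a outputs encodeBool b in-time t ×
    t ≤ c * size (encode a) ^ d + c ×
    (b ≡ true ⇔ Q a)

{-# OPTIONS --safe #-}

-- Two rules are related by a term isomorphism iff their terms have the
-- same shape, the induced correspondence between symbols is a partial
-- injection, and some arity-preserving bijections of 𝓕 and of 𝓥 exist at
-- all: composing these with transpositions makes them extend the partial
-- injection.  For systems in normal form a local isomorphism then exists
-- iff every rule of either system is related to a rule of the other.
--
-- All of this is computed by cons-free programs with structural recursion.
-- The values of such a program are subtrees of its input or constants, so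
-- its running time is polynomial, by induction on the program.  A fixed
-- first-order program interprets all cons-free ones.

module Submission where

open import Data.Bool.Base as Bool using (Bool)
open import Data.Empty using (⊥-elim)
open import Data.Fin.Base using (Fin; zero; suc; toℕ; cast; _↑ʳ_)
open import Data.Fin.Patterns
open import Data.Fin.Permutation using (cast-id; _∘ₚ_; transpose)
open import Data.Fin.Permutation.Components using () renaming (transpose to swap)
import Data.Fin.Properties as Fin
open import Data.List.Base as List using (List; []; _∷_; _++_; length; filter; allFin)
open import Data.List.Membership.Propositional using (_∈_; find; lose)
open import Data.List.Membership.Propositional.Properties
  using (∈-allFin; ∈-filter⁻; ∈-lookup; ∈-map⁺; ∈-∃++)
open import Data.List.Membership.Propositional.Properties.WithK using (unique∧set⇒bag)
import Data.List.Properties as List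
open import Data.List.Relation.Binary.BagAndSetEquality using (∼bag⇒↭)
open import Data.List.Relation.Binary.Permutation.Homogeneous using (onIndices)
open import Data.List.Relation.Binary.Permutation.Propositional
  using (_↭_; ↭-refl; ↭-prep; ↭-sym; ↭-trans; ↭⇒↭ₛ)
open import Data.List.Relation.Binary.Permutation.Propositional.Properties
  using (filter-↭; map⁺; shift; ↭-length)
open import Data.List.Relation.Binary.Permutation.Setoid.Properties using (onIndices-lookup)
open import Data.List.Relation.Unary.All as All using (All; []; _∷_)
import Data.List.Relation.Unary.All.Properties as All
open import Data.List.Relation.Unary.Any as Any using (Any; here; there)
import Data.List.Relation.Unary.Any.Properties as Any
import Data.List.Relation.Unary.Unique.Propositional.Properties as Unique
open import Data.Nat.Base
open import Data.Nat.Binary.Base using (ℕᵇ; 2[1+_]; 1+[2_])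
open import Data.Nat.Binary.Properties using (fromℕ-injective)
open import Data.Nat.Properties
open import Data.Nat.Solver using (module +-*-Solver)
open import Data.Product.Base using (Σ-syntax; ∃-syntax; _×_; _,_; proj₁; proj₂)
open import Data.Unit.Base using (⊤; tt)
open import Data.Vec.Base as Vec using (Vec; []; _∷_; lookup; tabulate)
open import Data.Vec.Relation.Unary.All using ([]; _∷_) renaming (All to Allᵛ)
open import Data.Vec.Relation.Unary.All.Properties using (lookup⁺)
open import Function.Base using (_∘_)
open import Function.Bundles
  using (_⇔_; mk⇔; _⤖_; module Bijection; module Equivalence; module Inverse)
open import Function.Construct.Composition using (_⤖-∘_)
open import Function.Construct.Symmetry using (⤖-sym)
open import Function.Properties.Inverse using (↔⇒⤖)
open import Relation.Binary.Definitions using (DecidableEquality)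
open import Relation.Binary.PropositionalEquality as ≡
  using (_≡_; _≢_; refl; sym; cong; cong₂; subst)
open import Relation.Nullary using (Dec; yes; no; ¬_)
open import Relation.Nullary.Decidable
  using (True; toWitness; dec-true; dec-false; decidable-stable)
open import Defs
open +-*-Solver using (solve; con; _:+_; _:*_; _:=_)

-- Quantitatively: with N = input size + 5, every value met by a cons-free program has size at most
-- N, however deeply its recursions are nested. A recursion therefore makes at most N steps, each
-- costing what its components cost at the same N, and every nesting of `rec` adds one factor N.
--
-- The interpreter confines evaluation derivations to one place: they are built once, for its four
-- functions. After that, a decision procedure is correct as soon as the plain Agda function `⟦_⟧`
-- computes the right tree.
--
-- The price is that nothing can be stored. A table of corresponding symbols cannot be built, so for
-- every pair of symbols met while traversing two rules, both rules are traversed again to compare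
-- that pair with all the others. Deleting from a list is likewise only possible by passing to a
-- suffix.

private variable m n : ℕ

-- Cons-free programs

-- `rec x ps b u v s` recurses on the tree `x` with accumulators `ps`: `u` and `v` compute those of
-- the left and right calls, which lets a second tree be followed in step with `x`. The components
-- see the accumulators but not the surrounding environment. The bound 5 is the size of `args-mode`,
-- the largest constant needed.
data Code : ℕ → Set where
  var  : Fin n → Code n
  con  : (t : Tree) → size t ≤ 5 → Code n
  case : Code n → Code n → Code (2 + n) → Code n
  rec  : Code n → Vec (Code n) m → Code m → (u v : Vec (Code (2 + m)) m) →
         Code (4 + m) → Code n

caseᵗ : Tree → Tree → (Tree → Tree → Tree) → Tree
caseᵗ leaf       a f = a
caseᵗ (node l r) a f = f l r

recᵗ : (Vec Tree m → Tree) → (u v : Vec Tree (2 + m) → Vec Tree m) →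
       (Vec Tree (4 + m) → Tree) → Tree → Vec Tree m → Tree
recᵗ b u v s leaf       ps = b ps
recᵗ b u v s (node l r) ps =
  s (recᵗ b u v s l (u (l ∷ r ∷ ps)) ∷ recᵗ b u v s r (v (l ∷ r ∷ ps)) ∷ l ∷ r ∷ ps)

mutual
  ⟦_⟧ : Code n → Vec Tree n → Tree
  ⟦ var i ⟧            ρ = lookup ρ i
  ⟦ con t _ ⟧          ρ = t
  ⟦ case e e₁ e₂ ⟧     ρ = caseᵗ (⟦ e ⟧ ρ) (⟦ e₁ ⟧ ρ) (λ l r → ⟦ e₂ ⟧ (l ∷ r ∷ ρ))
  ⟦ rec x ps b u v s ⟧ ρ = recᵗ ⟦ b ⟧ ⟦ u ⟧* ⟦ v ⟧* ⟦ s ⟧ (⟦ x ⟧ ρ) (⟦ ps ⟧* ρ)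

  ⟦_⟧* : Vec (Code n) m → Vec Tree n → Vec Tree m
  ⟦ [] ⟧*     ρ = []
  ⟦ c ∷ cs ⟧* ρ = ⟦ c ⟧ ρ ∷ ⟦ cs ⟧* ρ

Small : ℕ → Vec Tree n → Set
Small N = Allᵛ (λ t → size t ≤ N)

size-left : ∀ l r {N} → size (node l r) ≤ N → size l ≤ N
size-left l r p = ≤-trans (≤-trans (m≤m+n (size l) (size r)) (n≤1+n _)) p

size-right : ∀ l r {N} → size (node l r) ≤ N → size r ≤ N
size-right l r p = ≤-trans (≤-trans (m≤n+m (size r) (size l)) (n≤1+n _)) p

module _ {N : ℕ} (5≤N : 5 ≤ N) where

  recᵗ-small : ∀ {b : Vec Tree m → Tree} {u v s} →
    (∀ {ρ} → Small N ρ → size (b ρ) ≤ N) →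
    (∀ {ρ} → Small N ρ → Small N (u ρ)) →
    (∀ {ρ} → Small N ρ → Small N (v ρ)) →
    (∀ {ρ} → Small N ρ → size (s ρ) ≤ N) →
    ∀ x {ps} → size x ≤ N → Small N ps → size (recᵗ b u v s x ps) ≤ N
  recᵗ-small b u v s leaf       x≤N ps≤N = b ps≤N
  recᵗ-small b u v s (node l r) x≤N ps≤N =
    s (recᵗ-small b u v s l l≤N (u (l≤N ∷ r≤N ∷ ps≤N)) ∷
       recᵗ-small b u v s r r≤N (v (l≤N ∷ r≤N ∷ ps≤N)) ∷ l≤N ∷ r≤N ∷ ps≤N)
    where
    l≤N = size-left l r x≤N
    r≤N = size-right l r x≤N

  mutual
    -- No clause of `⟦_⟧` applies `node`, so the same N survives every nesting of recursions.
    small : (c : Code n) → ∀ {ρ} → Small N ρ → size (⟦ c ⟧ ρ) ≤ N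
    small (var i)            ρ≤N = lookup⁺ ρ≤N i
    small (con t t≤5)        ρ≤N = ≤-trans t≤5 5≤N
    small (case e e₁ e₂) {ρ} ρ≤N with ⟦ e ⟧ ρ | small e ρ≤N
    ... | leaf     | _   = small e₁ ρ≤N
    ... | node l r | p = small e₂ (size-left l r p ∷ size-right l r p ∷ ρ≤N)
    small (rec x ps b u v s) {ρ} ρ≤N =
      recᵗ-small (small b) (small* u) (small* v) (small s) (⟦ x ⟧ ρ)
                 (small x ρ≤N) (small* ps ρ≤N)

    small* : (cs : Vec (Code n) m) → ∀ {ρ} → Small N ρ → Small N (⟦ cs ⟧* ρ)
    small* []       ρ≤N = []
    small* (c ∷ cs) ρ≤N = small c ρ≤N ∷ small* cs ρ≤N

-- The interpreter

pattern trueᵗ = node leaf leaf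

pattern var-tag  = leaf
pattern con-tag  = node leaf leaf
pattern case-tag = node leaf (node leaf leaf)
pattern rec-tag  = node (node leaf leaf) leaf

unary : ℕ → Tree
unary zero    = leaf
unary (suc i) = node leaf (unary i)

tuple : Vec Tree n → Tree
tuple []       = leaf
tuple (t ∷ ts) = node t (tuple ts)

mutual
  ⌜_⌝ : Code n → Tree
  ⌜ var i ⌝            = node var-tag (unary (toℕ i))
  ⌜ con t _ ⌝          = node con-tag t
  ⌜ case e e₁ e₂ ⌝     = node case-tag (node ⌜ e ⌝ (node ⌜ e₁ ⌝ ⌜ e₂ ⌝))
  ⌜ rec x ps b u v s ⌝ = node rec-tag (node ⌜ x ⌝ (node ⌜ ps ⌝* (bundle b u v s)))

  bundle : Code m → (u v : Vec (Code (2 + m)) m) → Code (4 + m) → Tree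
  bundle b u v s = node ⌜ b ⌝ (node ⌜ u ⌝* (node ⌜ v ⌝* ⌜ s ⌝))

  ⌜_⌝* : Vec (Code n) m → Tree
  ⌜ [] ⌝*     = leaf
  ⌜ c ∷ cs ⌝* = node ⌜ c ⌝ ⌜ cs ⌝*

pattern eval  = 0F
pattern evals = 1F
pattern fetch = 2F
pattern recur = 3F

arity : Fin 4 → ℕ
arity eval  = 2
arity evals = 2
arity fetch = 2
arity recur = 3

pattern 10F = suc 9F
pattern 11F = suc 10F
pattern 12F = suc 11F
pattern 13F = suc 12F

-- `eval` and `evals` take code and environment, `fetch` an index and an environment, `recur` the
-- recursion argument, the accumulators and the `bundle`, which is passed on unchanged. Every `case`
-- shifts the variables by two. A `leaf` branch is a default for malformed input, except in `evals`,
-- where it is the empty tuple.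
body : (f : Fin 4) → Expr arity (arity f)
body eval = case (var 0F) leaf (case (var 0F)
  (call fetch (var 1F ∷ var 3F ∷ []))
  (case (var 0F)
    (case (var 1F)
      (var 3F)
      (case (var 5F) leaf (case (var 1F) leaf
        (case (call eval (var 2F ∷ var 11F ∷ []))
          (call eval (var 0F ∷ var 11F ∷ []))
          (call eval (var 3F ∷ node (var 0F) (node (var 1F) (var 13F)) ∷ []))))))
    (case (var 5F) leaf (case (var 1F) leaf
      (call recur (call eval (var 2F ∷ var 11F ∷ []) ∷ call evals (var 0F ∷ var 11F ∷ []) ∷
                var 1F ∷ []))))))
body evals = case (var 0F) leaf
  (node (call eval (var 0F ∷ var 3F ∷ [])) (call evals (var 1F ∷ var 3F ∷ [])))
body fetch = case (var 0F)
  (case (var 1F) leaf (var 0F))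
  (case (var 3F) leaf (call fetch (var 3F ∷ var 1F ∷ [])))
body recur = case (var 2F) leaf (case (var 1F) leaf (case (var 1F) leaf (case (var 6F)
  (call eval (var 4F ∷ var 7F ∷ []))
  (call eval (var 3F ∷
    node (call recur (var 0F ∷ call evals (var 4F ∷ env ∷ []) ∷ var 10F ∷ []))
         (node (call recur (var 1F ∷ call evals (var 2F ∷ env ∷ []) ∷ var 10F ∷ []))
               env) ∷ [])))))
  where
  env = node (var 0F) (node (var 1F) (var 9F))

-- K bounds the overhead of interpreting one constructor.
opaque
  K : ℕ
  K = 60

  ≤K : ∀ k {_ : True (k ≤? 60)} → k ≤ K
  ≤K k {p} = toWitness p

mutual
  -- `cost-rec` is charged once per constructor of the recursion argument, of which there are at
  -- most N by `small`. The charge is uniform because the components only ever run in environments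
  -- bounded by N.
  cost : Code n → ℕ → ℕ
  cost (var i)            N = K + suc (toℕ i) * K
  cost (con t _)          N = K
  cost (case e e₁ e₂)     N = K + (cost e N + (cost e₁ N + cost e₂ N))
  cost (rec x ps b u v s) N =
    K + (cost x N + (cost* ps N + cost-rec b u v s N * N))

  cost* : Vec (Code n) m → ℕ → ℕ
  cost* []       N = K
  cost* (c ∷ cs) N = K + (cost c N + cost* cs N)

  cost-rec : Code m → (u v : Vec (Code (2 + m)) m) → Code (4 + m) → ℕ → ℕ
  cost-rec b u v s N = K + (cost b N + (cost* u N + (cost* v N + cost s N)))

literal : Tree → Expr arity n
literal leaf       = leaf
literal (node l r) = node (literal l) (literal r)

module Interpreter (main : Expr arity 1) where

  program : Program
  program = record { functions = 4 ; arity = arity ; body = body ; main = main }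

  open Evaluation program

  literal-⇓ : ∀ t {ρ : Vec Tree n} → ρ ⊢ literal t ⇓ t ⟨ size t ⟩
  literal-⇓ leaf       = leaf
  literal-⇓ (node l r) = node (literal-⇓ l) (literal-⇓ r)

  infix 4 _⊢_⇓_within_
  data _⊢_⇓_within_ (ρ : Vec Tree n) (e : Expr arity n) (v : Tree) (b : ℕ) : Set where
    _,_ : ∀ {t} → ρ ⊢ e ⇓ v ⟨ t ⟩ → t ≤ b → ρ ⊢ e ⇓ v within b

  fetch-⇓ : ∀ (i : Fin n) (ρ : Vec Tree n) →
         unary (toℕ i) ∷ tuple ρ ∷ [] ⊢ body fetch ⇓ lookup ρ i within K + toℕ i * K
  fetch-⇓ zero    (t ∷ ρ) = case-leaf var (case-node var var) , ≤-trans (≤K 5) (m≤m+n K _)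
  fetch-⇓ (suc i) (t ∷ ρ) with fetch-⇓ i ρ
  ... | d , t≤ = case-node var (case-node var (call (var ∷ var ∷ []) d)) ,
    +-mono-≤ (≤K 7) t≤

  -- The left side is the form in which the step count of a derivation comes out, with fixed
  -- overheads between the times of the subderivations. One `K` absorbs all the overheads.
  sum₂ : ∀ k k′ {_ : True (k + k′ ≤? 60)} {t₁ t₂ b₁ b₂} → t₁ ≤ b₁ → t₂ ≤ b₂ →
         k + (t₁ + (k′ + t₂)) ≤ K + (b₁ + b₂)
  sum₂ k k′ {≤60} {t₁} {t₂} p q = ≤-trans
    (≤-reflexive (solve 4 (λ k k′ t₁ t₂ → k :+ (t₁ :+ (k′ :+ t₂)) := (k :+ k′) :+ (t₁ :+ t₂))
                   refl k k′ t₁ t₂))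
    (+-mono-≤ (≤K (k + k′) {≤60}) (+-mono-≤ p q))

  sum₃ : ∀ k k′ k″ {_ : True (k + (k′ + k″) ≤? 60)} {t₁ t₂ t₃ b₁ b₂ b₃} →
         t₁ ≤ b₁ → t₂ ≤ b₂ → t₃ ≤ b₃ →
         k + ((t₁ + (k′ + (t₂ + k″))) + t₃) ≤ K + (b₁ + (b₂ + b₃))
  sum₃ k k′ k″ {≤60} {t₁} {t₂} {t₃} p q r = ≤-trans
    (≤-reflexive (solve 6 (λ k k′ k″ t₁ t₂ t₃ → k :+ ((t₁ :+ (k′ :+ (t₂ :+ k″))) :+ t₃) :=
                             (k :+ (k′ :+ k″)) :+ (t₁ :+ (t₂ :+ t₃)))
                   refl k k′ k″ t₁ t₂ t₃))
    (+-mono-≤ (≤K (k + (k′ + k″)) {≤60}) (+-mono-≤ p (+-mono-≤ q r)))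

  module _ {N : ℕ} (5≤N : 5 ≤ N) where
    mutual
      eval-⇓ : ∀ (c : Code n) {ρ} → Small N ρ →
             ⌜ c ⌝ ∷ tuple ρ ∷ [] ⊢ body eval ⇓ ⟦ c ⟧ ρ within cost c N
      eval-⇓ (var i) {ρ} ρ≤N with fetch-⇓ i ρ
      ... | _,_ {t} d t≤ =
        case-node var (case-leaf var (call (var ∷ var ∷ []) d)) ,
        +-mono-≤ (≤K 7) t≤
      eval-⇓ (con t _) ρ≤N =
        case-node var (case-node var (case-leaf var (case-leaf var var))) , ≤K _
      eval-⇓ (case e e₁ e₂) {ρ} ρ≤N with ⟦ e ⟧ ρ | eval-⇓ e ρ≤N | small 5≤N e ρ≤N
      ... | leaf | _,_ {t} d t≤ | _ with eval-⇓ e₁ ρ≤N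
      ...   | _,_ {t₁} d₁ t₁≤ =
        case-node var (case-node var (case-leaf var (case-node var (case-node var (case-node var
          (case-leaf (call (var ∷ var ∷ []) d) (call (var ∷ var ∷ []) d₁))))))) ,
        sum₂ 16 3 t≤ (≤-trans t₁≤ (m≤m+n _ _))
      eval-⇓ (case e e₁ e₂) {ρ} ρ≤N | node l r | _,_ {t} d t≤ | p
        with eval-⇓ e₂ (size-left l r p ∷ size-right l r p ∷ ρ≤N)
      ...   | _,_ {t₂} d₂ t₂≤ =
        case-node var (case-node var (case-leaf var (case-node var (case-node var (case-node var
          (case-node (call (var ∷ var ∷ []) d)
            (call (var ∷ node var (node var var) ∷ []) d₂))))))) ,
        sum₂ 16 7 t≤ (≤-trans t₂≤ (m≤n+m _ _))
      eval-⇓ (rec x ps b u v s) {ρ} ρ≤N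
        with eval-⇓ x ρ≤N | evals-⇓ ps ρ≤N
           | recur-⇓ b u v s (⟦ x ⟧ ρ) (small 5≤N x ρ≤N) (small* 5≤N ps ρ≤N)
      ... | _,_ {t₁} d₁ t₁≤ | _,_ {t₂} d₂ t₂≤ | _,_ {t₃} d₃ t₃≤ =
        case-node var (case-node var (case-node var (case-node var (case-node var
          (call (call (var ∷ var ∷ []) d₁ ∷ call (var ∷ var ∷ []) d₂ ∷ var ∷ []) d₃))))) ,
        sum₃ 14 3 1 t₁≤ t₂≤
          (≤-trans t₃≤ (*-monoʳ-≤ (cost-rec b u v s N) (small 5≤N x ρ≤N)))

      evals-⇓ : ∀ (cs : Vec (Code n) m) {ρ} → Small N ρ →
              ⌜ cs ⌝* ∷ tuple ρ ∷ [] ⊢ body evals ⇓ tuple (⟦ cs ⟧* ρ) within cost* cs N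
      evals-⇓ []       ρ≤N = case-leaf var leaf , ≤K _
      evals-⇓ (c ∷ cs) ρ≤N with eval-⇓ c ρ≤N | evals-⇓ cs ρ≤N
      ... | _,_ {t₁} d₁ t₁≤ | _,_ {t₂} d₂ t₂≤ =
        case-node var (node (call (var ∷ var ∷ []) d₁) (call (var ∷ var ∷ []) d₂)) ,
        sum₂ 6 3 t₁≤ t₂≤

      recur-⇓ : ∀ (b : Code m) u v s x {ps} → size x ≤ N → Small N ps →
             x ∷ tuple ps ∷ bundle b u v s ∷ [] ⊢ body recur
               ⇓ recᵗ ⟦ b ⟧ ⟦ u ⟧* ⟦ v ⟧* ⟦ s ⟧ x ps within cost-rec b u v s N * size x
      recur-⇓ b u v s leaf x≤N ps≤N with eval-⇓ b ps≤N
      ... | _,_ {t} d t≤ =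
        case-node var (case-node var (case-node var (case-leaf var (call (var ∷ var ∷ []) d)))) ,
        ≤-trans (+-mono-≤ (≤K 11) (≤-trans t≤ (m≤m+n _ _)))
                (≤-reflexive (sym (*-identityʳ (cost-rec b u v s N))))
      recur-⇓ b u v s (node l r) {ps} x≤N ps≤N
        with evals-⇓ u (l≤N ∷ r≤N ∷ ps≤N) | evals-⇓ v (l≤N ∷ r≤N ∷ ps≤N)
           | recur-⇓ b u v s l l≤N (small* 5≤N u (l≤N ∷ r≤N ∷ ps≤N))
           | recur-⇓ b u v s r r≤N (small* 5≤N v (l≤N ∷ r≤N ∷ ps≤N))
           | eval-⇓ s (recᵗ-small 5≤N (small 5≤N b) (small* 5≤N u) (small* 5≤N v) (small 5≤N s) l
                       l≤N (small* 5≤N u (l≤N ∷ r≤N ∷ ps≤N)) ∷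
                     recᵗ-small 5≤N (small 5≤N b) (small* 5≤N u) (small* 5≤N v) (small 5≤N s) r
                       r≤N (small* 5≤N v (l≤N ∷ r≤N ∷ ps≤N)) ∷ l≤N ∷ r≤N ∷ ps≤N)
        where
        l≤N = size-left l r x≤N
        r≤N = size-right l r x≤N
      ... | _,_ {tᵤ} dᵤ tᵤ≤ | _,_ {tᵥ} dᵥ tᵥ≤ | _,_ {tₗ} dₗ tₗ≤ | _,_ {tᵣ} dᵣ tᵣ≤ | _,_ {tₛ} dₛ tₛ≤ =
        case-node var (case-node var (case-node var (case-node var (call (var ∷ node
          (call (var ∷ call (var ∷ node var (node var var) ∷ []) dᵤ ∷ var ∷ []) dₗ) (node
          (call (var ∷ call (var ∷ node var (node var var) ∷ []) dᵥ ∷ var ∷ []) dᵣ)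
          (node var (node var var))) ∷ []) dₛ)))) ,
        node-sum
        where
        W = cost-rec b u v s N
        -- The overhead is 37 = 20 + 1 + 10 + 1 + 5, the largest that `K` has to cover. One `W` pays
        -- for this node, with `cost b N` as slack; the recursive calls account for `W * size l` and
        -- `W * size r`.
        node-sum : 20 + (((((tᵤ + 1) + tₗ) + (10 + (((tᵥ + 1) + tᵣ) + 5))) + 0) + tₛ)
                   ≤ W * suc (size l + size r)
        node-sum = ≤-trans
          (≤-reflexive (solve 5 (λ a b c d e →
              con 20 :+ (((((a :+ con 1) :+ b) :+ (con 10 :+ (((c :+ con 1) :+ d) :+ con 5)))
                          :+ con 0) :+ e)
              := con 37 :+ ((a :+ (c :+ e)) :+ (b :+ d)))
            refl tᵤ tₗ tᵥ tᵣ tₛ))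
          (≤-trans
            (+-mono-≤ (≤K 37) (+-mono-≤ (≤-trans (+-mono-≤ tᵤ≤ (+-mono-≤ tᵥ≤ tₛ≤)) (m≤n+m _ (cost b N)))
                                        (+-mono-≤ tₗ≤ tᵣ≤)))
            (≤-reflexive (≡.trans (sym (+-assoc K _ _))
              (≡.trans (cong (W +_) (sym (*-distribˡ-+ W (size l) (size r))))
                       (sym (*-suc W (size l + size r)))))))

-- Polynomial bounds

-- The base `suc N` is never 0, so powers are monotone in the exponent and `poly-+` can simply add
-- degrees instead of taking a maximum.
Polynomial : (ℕ → ℕ) → Set
Polynomial f = ∃[ a ] ∃[ d ] ∀ N → f N ≤ a * suc N ^ d

private variable f g : ℕ → ℕ

poly-const : ∀ k → Polynomial (λ _ → k)
poly-const k = k , 0 , λ N → ≤-reflexive (sym (*-identityʳ k))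

poly-id : Polynomial (λ N → N)
poly-id = 1 , 1 , λ N → ≤-trans (n≤1+n N) (≤-reflexive (sym (≡.trans (*-identityˡ _) (*-identityʳ _))))

poly-+ : Polynomial f → Polynomial g → Polynomial (λ N → f N + g N)
poly-+ (a , d , p) (b , e , q) = a + b , d + e , λ N → ≤-trans
  (+-mono-≤ (≤-trans (p N) (*-monoʳ-≤ a (^-monoʳ-≤ (suc N) (m≤m+n d e))))
            (≤-trans (q N) (*-monoʳ-≤ b (^-monoʳ-≤ (suc N) (m≤n+m e d)))))
  (≤-reflexive (sym (*-distribʳ-+ (suc N ^ (d + e)) a b)))

poly-* : Polynomial f → Polynomial g → Polynomial (λ N → f N * g N)
poly-* (a , d , p) (b , e , q) = a * b , d + e , λ N → ≤-trans
  (*-mono-≤ (p N) (q N))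
  (≤-reflexive (≡.trans
    (solve 4 (λ a x b y → (a :* x) :* (b :* y) := (a :* b) :* (x :* y)) refl a (suc N ^ d) b (suc N ^ e))
    (cong (a * b *_) (sym (^-distribˡ-+-* (suc N) d e)))))

mutual
  cost-poly : (c : Code n) → Polynomial (cost c)
  cost-poly (var i)            = poly-const (K + suc (toℕ i) * K)
  cost-poly (con t _)          = poly-const K
  cost-poly (case e e₁ e₂)     =
    poly-+ (poly-const K) (poly-+ (cost-poly e) (poly-+ (cost-poly e₁) (cost-poly e₂)))
  cost-poly (rec x ps b u v s) =
    poly-+ (poly-const K) (poly-+ (cost-poly x) (poly-+ (cost*-poly ps)
      (poly-* (poly-+ (poly-const K) (poly-+ (cost-poly b) (poly-+ (cost*-poly u)
        (poly-+ (cost*-poly v) (cost-poly s))))) poly-id)))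

  cost*-poly : (cs : Vec (Code n) m) → Polynomial (cost* cs)
  cost*-poly []       = poly-const K
  cost*-poly (c ∷ cs) = poly-+ (poly-const K) (poly-+ (cost-poly c) (cost*-poly cs))

^-distribʳ-* : ∀ d m n → (m * n) ^ d ≡ m ^ d * n ^ d
^-distribʳ-* zero    m n = refl
^-distribʳ-* (suc d) m n = ≡.trans (cong (m * n *_) (^-distribʳ-* d m n))
  (solve 4 (λ m n x y → (m :* n) :* (x :* y) := (m :* x) :* (n :* y)) refl m n (m ^ d) (n ^ d))

1≤size : ∀ t → 1 ≤ size t
1≤size leaf       = ≤-refl
1≤size (node l r) = s≤s z≤n

-- The code sits in `main` as a literal, so building it takes a constant number of steps; only its
-- interpretation depends on the input.
code-polytime : (c : Code 1) → Σ[ P ∈ Program ] ∃[ k ] ∃[ d ] ∀ input → ∃[ t ]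
  P on input outputs ⟦ c ⟧ (input ∷ []) in-time t × t ≤ k * size input ^ d + k
code-polytime c with cost-poly c
... | a , d , poly = program , k , d , run
  where
  main : Expr arity 1
  main = call eval (literal ⌜ c ⌝ ∷ node (var zero) leaf ∷ [])
  open Interpreter main
  open Evaluation program

  -- One step for `call`, three for the environment `node (var zero) leaf`, and `size ⌜ c ⌝` for the
  -- literal.
  k₀ = 4 + size ⌜ c ⌝
  k = k₀ + a * 7 ^ d

  bound : ∀ s → 1 ≤ s → ∀ {t} → t ≤ cost c (s + 5) →
          suc (size ⌜ c ⌝ + (3 + 0) + t) ≤ k * s ^ d + k
  bound s 1≤s {t} t≤ = begin
    suc (size ⌜ c ⌝ + 3 + t)
      ≡⟨ solve 2 (λ x t → con 1 :+ ((x :+ con 3) :+ t) := (con 4 :+ x) :+ t) refl (size ⌜ c ⌝) t ⟩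
    k₀ + t                        ≤⟨ +-monoʳ-≤ k₀ (≤-trans t≤ (poly (s + 5))) ⟩
    k₀ + a * suc (s + 5) ^ d      ≤⟨ +-monoʳ-≤ k₀ (*-monoʳ-≤ a (^-monoˡ-≤ d 6+s≤7s)) ⟩
    k₀ + a * (7 * s) ^ d          ≡⟨ cong (λ x → k₀ + a * x) (^-distribʳ-* d 7 s) ⟩
    k₀ + a * (7 ^ d * s ^ d)      ≡⟨ cong (k₀ +_) (sym (*-assoc a (7 ^ d) (s ^ d))) ⟩
    k₀ + a * 7 ^ d * s ^ d        ≤⟨ +-mono-≤ (m≤m+n k₀ (a * 7 ^ d))
                                                (*-monoˡ-≤ (s ^ d) (m≤n+m (a * 7 ^ d) k₀)) ⟩
    k + k * s ^ d                 ≡⟨ +-comm k _ ⟩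
    k * s ^ d + k                 ∎
    where
    open ≤-Reasoning
    -- As `1 ≤ s`, the additive 6 becomes a factor, which then goes into `k` as `7 ^ d`.
    6+s≤7s : suc (s + 5) ≤ 7 * s
    6+s≤7s = begin
      suc (s + 5)  ≡⟨ solve 1 (λ s → con 1 :+ (s :+ con 5) := s :+ con 6) refl s ⟩
      s + 6 * 1    ≤⟨ +-monoʳ-≤ s (*-monoʳ-≤ 6 1≤s) ⟩
      7 * s        ∎

  run : ∀ input → ∃[ t ] program on input outputs ⟦ c ⟧ (input ∷ []) in-time t ×
        t ≤ k * size input ^ d + k
  run input with eval-⇓ {N = size input + 5} (m≤n+m 5 (size input)) c {input ∷ []} (m≤m+n _ 5 ∷ [])
  ... | der , t≤ = _ ,
    call (literal-⇓ ⌜ c ⌝ ∷ node var leaf ∷ []) der ,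
    bound (size input) (1≤size input) t≤

-- Decision procedures

v0 : Code (1 + n)
v0 = var 0F
v1 : Code (2 + n)
v1 = var 1F
v2 : Code (3 + n)
v2 = var 2F
v3 : Code (4 + n)
v3 = var 3F
v4 : Code (5 + n)
v4 = var 4F
v5 : Code (6 + n)
v5 = var 5F
v6 : Code (7 + n)
v6 = var 6F
v7 : Code (8 + n)
v7 = var 7F

false true : Code n
false = con leaf (≤ᵇ⇒≤ _ _ _)
true  = con trueᵗ (≤ᵇ⇒≤ _ _ _)

project : (Fin m → Fin n) → Vec (Code n) m
project g = tabulate (λ i → var (g i))

⟦project⟧ : ∀ (g : Fin m → Fin n) {ρ} ρ′ → (∀ i → lookup ρ (g i) ≡ lookup ρ′ i) →
            ⟦ project g ⟧* ρ ≡ ρ′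
⟦project⟧ g []       eq = refl
⟦project⟧ g (t ∷ ρ′) eq = cong₂ _∷_ (eq zero) (⟦project⟧ (λ i → g (suc i)) ρ′ (λ i → eq (suc i)))

drop2 : Vec (Code (2 + n)) n
drop2 = project (λ i → suc (suc i))

drop4 : Vec (Code (4 + n)) n
drop4 = project (λ i → suc (suc (suc (suc i))))

-- Recursion on the constant leaf runs only the base case, so this evaluates `c` in the environment
-- `es`. It serves as function call, as `let` and as weakening; the other components are fillers.
call′ : Code m → Vec (Code n) m → Code n
call′ c es = rec false es c drop2 drop2 false

-- Both branches are evaluated, so that they need no weakening.
if : Code n → Code n → Code n → Code n
if c d e = call′ (case v0 v2 v3) (c ∷ d ∷ e ∷ [])

infixr 6 _∧_
_∧_ : Code n → Code n → Code n
c ∧ d = if c d false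

not : Code n → Code n
not c = if c false true

headᶜ tailᶜ : Code n → Code n
headᶜ c = call′ (case v0 false v0) (c ∷ [])
tailᶜ c = call′ (case v0 false v1) (c ∷ [])

data Decides (P : Set) : Tree → Set where
  holds : P → Decides P trueᵗ
  fails : ¬ P → Decides P leaf

private variable
  P Q : Set
  t t₁ t₂ : Tree

decides⇒dec : Decides P t → Dec P
decides⇒dec (holds p) = yes p
decides⇒dec (fails ¬p) = no ¬p

decides-⇔ : P ⇔ Q → Decides P t → Decides Q t
decides-⇔ e (holds p) = holds (Equivalence.to e p)
decides-⇔ e (fails ¬p) = fails (λ q → ¬p (Equivalence.from e q))

ifᵗ : Tree → Tree → Tree → Tree
ifᵗ c d e = caseᵗ c e (λ _ _ → d)

-- The second test only has to be correct when `P` holds. This is how the test for a local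
-- isomorphism can rely on normal forms.
decides-∧ : Decides P t → (P → Decides Q t₁) → Decides (P × Q) (ifᵗ t t₁ leaf)
decides-∧ (fails ¬p) d = fails (λ (p , _) → ¬p p)
decides-∧ (holds p) d with d p
... | holds q = holds (p , q)
... | fails ¬q = fails (λ (_ , q) → ¬q q)

decides-¬ : Decides P t → Decides (¬ P) (ifᵗ t leaf trueᵗ)
decides-¬ (holds p) = fails (λ ¬p → ¬p p)
decides-¬ (fails ¬p) = holds ¬p

decides⇒polyTimeDecidable : ∀ {A : Set} {Q : A → Set} (enc : A → Tree) (c : Code 1) →
  (∀ a → Decides (Q a) (⟦ c ⟧ (enc a ∷ []))) → PolyTimeDecidable enc Q
decides⇒polyTimeDecidable {Q = Q} enc c d with code-polytime c
... | P , k , e , run = P , k , e , λ a → answer a (run (enc a)) (d a)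
  where
  answer : ∀ a {v} →
    ∃[ t ] P on enc a outputs v in-time t × t ≤ k * size (enc a) ^ e + k → Decides (Q a) v →
    ∃[ b ] ∃[ t ] P on enc a outputs encodeBool b in-time t ×
      t ≤ k * size (enc a) ^ e + k × (b ≡ Bool.true ⇔ Q a)
  answer a (t , out , t≤) (holds q)  =
    Bool.true , t , out , t≤ , mk⇔ (λ _ → q) (λ _ → refl)
  answer a (t , out , t≤) (fails ¬q) =
    Bool.false , t , out , t≤ , mk⇔ (λ ()) (λ q → ⊥-elim (¬q q))

-- Equality

opaque
  -- The second tree is the accumulator. The `leaf` standing for a missing head or tail does no
  -- harm: a node against a leaf is rejected whatever the recursive results are.
  equality : Code 2
  equality = rec v0 (v1 ∷ []) (if v0 false true)
    (headᶜ v2 ∷ []) (tailᶜ v2 ∷ []) (case v4 false (v2 ∧ v3))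

eqᵗ : Tree → Tree → Tree
eqᵗ x y = ⟦ equality ⟧ (x ∷ y ∷ [])

_==_ : Code n → Code n → Code n
c == d = call′ equality (c ∷ d ∷ [])

opaque
  unfolding equality

  eq-decides : ∀ x y → Decides (x ≡ y) (eqᵗ x y)
  eq-decides leaf       leaf         = holds refl
  eq-decides leaf       (node _ _)   = fails λ ()
  eq-decides (node l r) leaf         = fails λ ()
  eq-decides (node l r) (node l′ r′) =
    decides-⇔ (mk⇔ (λ { (refl , refl) → refl }) (λ { refl → refl , refl }))
      (decides-∧ (eq-decides l l′) (λ _ → eq-decides r r′))

_≟ᵗ_ : DecidableEquality Tree
x ≟ᵗ y = decides⇒dec (eq-decides x y)

-- Bounded quantifiers

opaque
  -- `rec` also descends into the elements of the list. That result is discarded: the step uses only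
  -- the result for the rest (`v1`) and the element itself (`v2`).
  all : Code n → Code (1 + n) → Code n
  all xs c = rec xs (project (λ i → i)) true drop2 drop2 (call′ c (v2 ∷ drop4) ∧ v1)

  all-decides : ∀ {A : Set} {P : A → Set} (enc : A → Tree) as xs (c : Code (1 + n)) ρ →
    ⟦ xs ⟧ ρ ≡ encodeList (List.map enc as) →
    (∀ a → Decides (P a) (⟦ c ⟧ (enc a ∷ ρ))) →
    Decides (All P as) (⟦ all xs c ⟧ ρ)
  all-decides {n} {A} {P} enc as xs c ρ eq d
    rewrite eq | ⟦project⟧ (λ i → i) {ρ} ρ (λ _ → refl) = go as
    where
    go : ∀ as → Decides (All P as)
      (recᵗ ⟦ true ⟧ ⟦ drop2 ⟧* ⟦ drop2 ⟧* ⟦ call′ c (v2 ∷ drop4) ∧ v1 ⟧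
            (encodeList (List.map enc as)) ρ)
    go []       = holds []
    go (a ∷ as)
      rewrite ⟦project⟧ (λ i → suc (suc i))
                {enc a ∷ encodeList (List.map enc as) ∷ ρ} ρ (λ _ → refl)
            | ⟦project⟧ (λ i → suc (suc (suc (suc i))))
                {recᵗ ⟦ true ⟧ ⟦ drop2 ⟧* ⟦ drop2 ⟧* ⟦ call′ c (v2 ∷ drop4) ∧ v1 ⟧ (enc a) ρ ∷
                 recᵗ ⟦ true ⟧ ⟦ drop2 ⟧* ⟦ drop2 ⟧* ⟦ call′ c (v2 ∷ drop4) ∧ v1 ⟧
                      (encodeList (List.map enc as)) ρ ∷
                 enc a ∷ encodeList (List.map enc as) ∷ ρ} ρ (λ _ → refl)
      = decides-⇔ (mk⇔ (λ (p , ps) → p ∷ ps) (λ { (p ∷ ps) → p , ps }))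
          (decides-∧ (d a) (λ _ → go as))

any : Code n → Code (1 + n) → Code n
any xs c = not (all xs (not c))

any-decides : ∀ {A : Set} {P : A → Set} (enc : A → Tree) as xs (c : Code (1 + n)) ρ →
  ⟦ xs ⟧ ρ ≡ encodeList (List.map enc as) →
  (∀ a → Decides (P a) (⟦ c ⟧ (enc a ∷ ρ))) →
  Decides (Any P as) (⟦ any xs c ⟧ ρ)
any-decides {P = P} enc as xs c ρ eq d =
  decides-⇔ (mk⇔ (some as) (λ p ¬p → All.All¬⇒¬Any ¬p p))
    (decides-¬ (all-decides enc as xs (not c) ρ eq (λ a → decides-¬ (d a))))
  where
  some : ∀ as → ¬ All (λ a → ¬ P a) as → Any P as
  some []       ¬all = ⊥-elim (¬all [])
  some (a ∷ as) ¬all with decides⇒dec (d a)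
  ... | yes p = here p
  ... | no ¬p = there (some as (λ ps → ¬all (¬p ∷ ps)))

-- Multisets of keys

-- The answer is the suffix that starts at the first element with the given key, or a leaf if there
-- is none. The current suffix is carried as an accumulator because it could not be rebuilt from
-- head and tail. The elements skipped have other keys, so the tail of the answer has lost exactly
-- one element with this key.
search : Code 1 → Code 2
search key = rec v1 (v1 ∷ v0 ∷ []) false drop2 (v1 ∷ v3 ∷ [])
  (if (call′ key (v2 ∷ []) == v5) v4 v1)

-- The number of elements with a given key is compared by deleting one
-- such element of ys for each such element of xs.
sameCount : Code 1 → Code 3
sameCount key = rec v1 (v2 ∷ v0 ∷ []) (if (call′ (search key) (v1 ∷ v0 ∷ [])) false true)
  drop2
  (if (call′ key (v0 ∷ []) == v3) (tailᶜ (call′ (search key) (v3 ∷ v2 ∷ []))) v2 ∷ v3 ∷ [])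
  (if (call′ key (v2 ∷ []) == v5) (if (call′ (search key) (v5 ∷ v4 ∷ [])) v1 false) v1)

sameKeyCount : Code 1 → Code 3
sameKeyCount key = call′ (sameCount key) (call′ key (v0 ∷ []) ∷ v1 ∷ v2 ∷ [])

opaque
  sameKeys : Code 1 → Code 2
  sameKeys key = all v0 (sameKeyCount key) ∧ all v1 (sameKeyCount key)

occ : Tree → List Tree → ℕ
occ a xs = length (filter (a ≟ᵗ_) xs)

occ-∈ : ∀ a xs → occ a xs ≢ 0 → a ∈ xs
occ-∈ a xs ≢0 with filter (a ≟ᵗ_) xs in eq
... | []    = ⊥-elim (≢0 refl)
... | y ∷ _ with ∈-filter⁻ (a ≟ᵗ_) {v = y} {xs = xs} (subst (y ∈_) (sym eq) (here refl))
...   | y∈xs , refl = y∈xs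

occ-↭ : ∀ a {xs ys} → xs ↭ ys → occ a xs ≡ occ a ys
occ-↭ a p = ↭-length (filter-↭ (a ≟ᵗ_) p)

occ-same : ∀ a xs → occ a (a ∷ xs) ≡ suc (occ a xs)
occ-same a xs = cong length (List.filter-accept (a ≟ᵗ_) {a} {xs} refl)

occ⇒↭ : ∀ xs ys → (∀ a → occ a xs ≡ occ a ys) → xs ↭ ys
occ⇒↭ []       []       eq = ↭-refl
occ⇒↭ []       (y ∷ ys) eq = ⊥-elim (0≢1+n (≡.trans (eq y) (occ-same y ys)))
occ⇒↭ (x ∷ xs) ys       eq
  with l , r , refl ← ∈-∃++ (occ-∈ x ys λ 0≡ →
    0≢1+n (≡.trans (sym (≡.trans (eq x) 0≡)) (occ-same x xs)))
  = ↭-trans (↭-prep x (occ⇒↭ xs (l ++ r) eq′)) (↭-sym (shift x l r))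
  where
  eq′ : ∀ a → occ a xs ≡ occ a (l ++ r)
  eq′ a with ≡.trans (eq a) (occ-↭ a (shift x l r))
  ... | e with a ≟ᵗ x
  ...   | yes _ = suc-injective e
  ...   | no  _ = e

module _ (keyᶜ : Code 1) where

  key : Tree → Tree
  key x = ⟦ keyᶜ ⟧ (x ∷ [])

  keys : List Tree → List Tree
  keys = List.map key

  data Found (a : Tree) (ys : List Tree) : Tree → Set where
    none : occ a (keys ys) ≡ 0 → Found a ys leaf
    some : ∀ y ys′ → occ a (keys ys) ≡ suc (occ a (keys ys′)) →
           Found a ys (node y (encodeList ys′))

  found : ∀ a ys → Found a ys (⟦ search keyᶜ ⟧ (a ∷ encodeList ys ∷ []))
  found a []       = none refl
  found a (y ∷ ys) with eqᵗ (key y) a | eq-decides (key y) a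
  ... | _ | holds k≡a = some y ys (cong length (List.filter-accept (a ≟ᵗ_) (sym k≡a)))
  ... | _ | fails k≢a with ⟦ search keyᶜ ⟧ (a ∷ encodeList ys ∷ []) | found a ys
  ...   | _ | none eq        = none (≡.trans (cong length (List.filter-reject (a ≟ᵗ_) (k≢a ∘ sym))) eq)
  ...   | _ | some y′ ys′ eq = some y′ ys′ (≡.trans (cong length (List.filter-reject (a ≟ᵗ_) (k≢a ∘ sym))) eq)

  sameCount-decides : ∀ a xs ys → Decides (occ a (keys xs) ≡ occ a (keys ys))
                        (⟦ sameCount keyᶜ ⟧ (a ∷ encodeList xs ∷ encodeList ys ∷ []))
  sameCount-decides a [] ys with ⟦ search keyᶜ ⟧ (a ∷ encodeList ys ∷ []) | found a ys
  ... | _ | none eq     = holds (sym eq)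
  ... | _ | some _ _ eq = fails λ p → 0≢1+n (≡.trans p eq)
  sameCount-decides a (x ∷ xs) ys with eqᵗ (key x) a | eq-decides (key x) a
  ... | _ | fails k≢a = subst (λ k → Decides (k ≡ _) _)
    (sym (cong length (List.filter-reject (a ≟ᵗ_) (k≢a ∘ sym)))) (sameCount-decides a xs ys)
  ... | _ | holds k≡a with ⟦ search keyᶜ ⟧ (a ∷ encodeList ys ∷ []) | found a ys
  ...   | _ | none eq = fails λ p → 0≢1+n (≡.trans (sym eq) (≡.trans (sym p)
                          (cong length (List.filter-accept (a ≟ᵗ_) (sym k≡a)))))
  ...   | _ | some y ys′ eq = subst (λ k → Decides (k ≡ _) _)
    (sym (cong length (List.filter-accept (a ≟ᵗ_) (sym k≡a))))
    (subst (λ k → Decides (_ ≡ k) _) (sym eq)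
      (decides-⇔ (mk⇔ (cong suc) suc-injective) (sameCount-decides a xs ys′)))

  -- It suffices to compare the counts of keys that occur in one of the lists, since any other key
  -- has count 0 on both sides.
  occ⇔↭ : ∀ xs ys → (All (λ x → occ (key x) (keys xs) ≡ occ (key x) (keys ys)) xs ×
                     All (λ y → occ (key y) (keys xs) ≡ occ (key y) (keys ys)) ys) ⇔
                    (keys xs ↭ keys ys)
  occ⇔↭ xs ys = mk⇔ (λ (pxs , pys) → occ⇒↭ (keys xs) (keys ys) (same pxs pys))
    (λ p → All.universal (λ x → occ-↭ (key x) p) xs , All.universal (λ y → occ-↭ (key y) p) ys)
    where
    Same : Tree → Set
    Same a = occ a (keys xs) ≡ occ a (keys ys)

    same : All (Same ∘ key) xs → All (Same ∘ key) ys → ∀ a → Same a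
    same pxs pys a with occ a (keys xs) ≟ 0 | occ a (keys ys) ≟ 0
    ... | no ≢0 | _     = All.lookup (All.map⁺ pxs) (occ-∈ a (keys xs) ≢0)
    ... | yes _ | no ≢0 = All.lookup (All.map⁺ pys) (occ-∈ a (keys ys) ≢0)
    ... | yes p | yes q = ≡.trans p (sym q)

  opaque
    unfolding sameKeys

    sameKeys-decides : ∀ xs ys → Decides (keys xs ↭ keys ys)
                         (⟦ sameKeys keyᶜ ⟧ (encodeList xs ∷ encodeList ys ∷ []))
    sameKeys-decides xs ys = decides-⇔ (occ⇔↭ xs ys)
      (decides-∧
        (all-decides (λ t → t) xs v0 (sameKeyCount keyᶜ) (encodeList xs ∷ encodeList ys ∷ [])
          (cong encodeList (sym (List.map-id xs))) (λ x → sameCount-decides (key x) xs ys))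
        (λ _ → all-decides (λ t → t) ys v1 (sameKeyCount keyᶜ) (encodeList xs ∷ encodeList ys ∷ [])
          (cong encodeList (sym (List.map-id ys))) (λ y → sameCount-decides (key y) xs ys)))

-- Colour-preserving bijections

swap-first : ∀ (i j : Fin n) → swap i j i ≡ j
swap-first i j rewrite dec-true (i Fin.≟ i) refl = refl

swap-other : ∀ {i j k : Fin n} → k ≢ i → k ≢ j → swap i j k ≡ k
swap-other {i = i} {j} {k} k≢i k≢j
  rewrite dec-false (k Fin.≟ i) k≢i | dec-false (k Fin.≟ j) k≢j = refl

module _ {C : Set} (c : Fin m → C) (c′ : Fin n → C) where

  Preserves : Fin m ⤖ Fin n → Set
  Preserves g = ∀ i → c′ (Bijection.to g i) ≡ c i

  ↭⇒bijection : List.tabulate c ↭ List.tabulate c′ → Σ[ g ∈ Fin m ⤖ Fin n ] Preserves g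
  ↭⇒bijection p = ↔⇒⤖ (cast-id (sym len) ∘ₚ π ∘ₚ cast-id len′) , preserves
    where
    len = List.length-tabulate c
    len′ = List.length-tabulate c′
    ↭ₛ = ↭⇒↭ₛ p
    π = onIndices ↭ₛ

    lookup-c′ : ∀ j → c′ (cast len′ j) ≡ List.lookup (List.tabulate c′) j
    lookup-c′ j = ≡.trans (sym (List.lookup-tabulate c′ _))
      (cong (List.lookup (List.tabulate c′)) (Fin.cast-involutive (sym len′) len′ j))

    preserves : ∀ i → c′ (cast len′ (Inverse.to π (cast (sym len) i))) ≡ c i
    preserves i = ≡.trans (lookup-c′ _)
      (≡.trans (sym (onIndices-lookup (≡.setoid C) ↭ₛ _)) (List.lookup-tabulate c i))

  -- The values of `g` list `Fin n` without repetition, hence are a permutation of `allFin n`;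
  -- applying `c′` to both lists preserves this.
  bijection⇒↭ : Σ[ g ∈ Fin m ⤖ Fin n ] Preserves g → List.tabulate c ↭ List.tabulate c′
  bijection⇒↭ (g , eq) = ≡.subst₂ _↭_
    (≡.trans (sym (List.map-∘ (allFin m)))
      (≡.trans (List.map-cong eq (allFin m)) (List.map-tabulate (λ i → i) c)))
    (List.map-tabulate (λ i → i) c′)
    (map⁺ c′ (∼bag⇒↭ (unique∧set⇒bag (Unique.map⁺ injective (Unique.allFin⁺ m)) (Unique.allFin⁺ n)
      (mk⇔ (λ _ → ∈-allFin _) (λ _ → image _)))))
    where
    open Bijection g using (to; injective; strictlySurjective)
    image : ∀ y → y ∈ List.map to (allFin m)
    image y with strictlySurjective y
    ... | x , refl = ∈-map⁺ to (∈-allFin x)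

  -- Pairwise coherence of a list of pairs says that it is the graph of a partial injection.
  Coherent : (p q : Fin m × Fin n) → Set
  Coherent p q = proj₁ p ≡ proj₁ q ⇔ proj₂ p ≡ proj₂ q

  -- A preserving bijection is made to map x to y by composing it with the
  -- transposition of y and the present image of x.
  extend : Σ[ g ∈ Fin m ⤖ Fin n ] Preserves g → ∀ ps →
           All (λ p → All (Coherent p) ps) ps → All (λ p → c′ (proj₂ p) ≡ c (proj₁ p)) ps →
           Σ[ g ∈ Fin m ⤖ Fin n ] Preserves g × All (λ p → Bijection.to g (proj₁ p) ≡ proj₂ p) ps
  extend (g , pres) []             coh            cols         = g , pres , []
  extend g₀         ((x , y) ∷ ps) ((_ ∷ xy) ∷ coh) (col ∷ cols)
    with extend g₀ ps (All.map All.tail coh) cols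
  ... | g , pres , maps = ↔⇒⤖ (transpose (to x) y) ⤖-∘ g , pres′ ,
                          (swap-first (to x) y ∷ All.zipWith (λ (e , q) → maps′ q e) (maps , xy))
    where
    open Bijection g using (to; injective)

    -- Both `to x` and `y` have the colour of `x`, so their transposition preserves colours.
    c′-swap : ∀ k → c′ (swap (to x) y k) ≡ c′ k
    c′-swap k with k Fin.≟ to x
    ... | yes refl = ≡.trans col (sym (pres x))
    ... | no _ with k Fin.≟ y
    ...   | yes refl = ≡.trans (pres x) (sym col)
    ...   | no _ = refl

    pres′ : ∀ i → c′ (swap (to x) y (to i)) ≡ c i
    pres′ i = ≡.trans (c′-swap (to i)) (pres i)

    -- Pairs already placed stay in place: if `y′` is `y`, coherence forces `x′` to be `x`;
    -- otherwise `y′` is neither `y` nor, by coherence and injectivity, `to x`, and the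
    -- transposition fixes it.
    maps′ : ∀ {p} → Coherent (x , y) p → to (proj₁ p) ≡ proj₂ p → swap (to x) y (to (proj₁ p)) ≡ proj₂ p
    maps′ {x′ , y′} xy⇔ eq with y′ Fin.≟ y
    ... | yes refl with refl ← Equivalence.from xy⇔ refl = swap-first (to x) y
    ... | no y′≢y = ≡.trans (cong (swap (to x) y) eq) (swap-other
        (λ y′≡tox → y′≢y (sym (Equivalence.to xy⇔ (injective (≡.trans (sym y′≡tox) (sym eq))))))
        y′≢y)

-- Simultaneous traversal of two encoded terms

-- The kinds of subtrees of an encoded term: a term, a function symbol
-- with its arguments, a list of arguments.
pattern term-mode = leaf
pattern app-mode  = trueᵗ
pattern args-mode = node trueᵗ leaf

headᵗ tailᵗ : Tree → Tree
headᵗ t = caseᵗ t leaf (λ l _ → l)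
tailᵗ t = caseᵗ t leaf (λ _ r → r)

childModeᵗ : Tree → Tree
childModeᵗ mode = caseᵗ mode app-mode (λ _ _ → args-mode)

-- Of the three kinds of subtrees, only a list of arguments can be encoded by a leaf.
baseᵗ : (mode y : Tree) → Tree
baseᵗ mode y = caseᵗ mode leaf (λ a _ → caseᵗ a leaf (λ _ _ → caseᵗ y trueᵗ (λ _ _ → leaf)))

-- The recursion also runs through tags and numerals, where its results mean nothing. The mode
-- selects what to use: at a variable only `B` on the names, at an application `resᵣ` alone, at a
-- function symbol `A` on the names and `resᵣ`, in a list of arguments both results.
stepᵗ : (A B : Tree → Tree → Tree) (resₗ resᵣ l r mode y : Tree) → Tree
stepᵗ A B resₗ resᵣ l r mode y = caseᵗ y leaf λ l′ r′ → caseᵗ mode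
  (caseᵗ l (ifᵗ l′ leaf (B r r′)) (λ _ _ → ifᵗ l′ resᵣ leaf))
  (λ a _ → caseᵗ a (ifᵗ (A l l′) resᵣ leaf) (λ _ _ → ifᵗ resₗ resᵣ leaf))

walkᵗ : (A B : Tree → Tree → Tree) (mode x y : Tree) → Tree
walkᵗ A B mode leaf       y = baseᵗ mode y
walkᵗ A B mode (node l r) y = stepᵗ A B
  (walkᵗ A B term-mode l (headᵗ y)) (walkᵗ A B (childModeᵗ mode) r (tailᵗ y)) l r mode y

module _ (A B : Code (2 + n)) where

  base : Code (2 + n)
  base = case v0 false (case v0 false (case v5 true false))

  goLeft goRight : Vec (Code (4 + n)) (2 + n)
  goLeft  = con term-mode (≤ᵇ⇒≤ _ _ _) ∷ headᶜ v3 ∷ project (λ i → 4 ↑ʳ i)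
  goRight = call′ (case v0 (con app-mode (≤ᵇ⇒≤ _ _ _)) (con args-mode (≤ᵇ⇒≤ _ _ _))) (v2 ∷ []) ∷
            tailᶜ v3 ∷ project (λ i → 4 ↑ʳ i)

  step : Code (6 + n)
  step = case v5 false (case v6
    (case v4 (if v0 false (call′ B (v5 ∷ v1 ∷ project (λ i → 8 ↑ʳ i)))) (if v2 v5 false))
    (case v0 (call′ A (v6 ∷ v2 ∷ project (λ i → 10 ↑ʳ i)) ∧ v5) (v6 ∧ v7)))

  opaque
    walk : Code n → Code n → Code n
    walk x y = rec x (con term-mode (≤ᵇ⇒≤ _ _ _) ∷ y ∷ project (λ i → i)) base goLeft goRight step

  module _ (ρ : Vec Tree n) where

    Aᵗ Bᵗ : Tree → Tree → Tree
    Aᵗ a b = ⟦ A ⟧ (a ∷ b ∷ ρ)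
    Bᵗ a b = ⟦ B ⟧ (a ∷ b ∷ ρ)

    ⟦base⟧ : ∀ mode y → ⟦ base ⟧ (mode ∷ y ∷ ρ) ≡ baseᵗ mode y
    ⟦base⟧ leaf                y = refl
    ⟦base⟧ (node leaf b)       y = refl
    ⟦base⟧ (node (node _ _) b) y = refl

    ⟦goLeft⟧ : ∀ l r mode y → ⟦ goLeft ⟧* (l ∷ r ∷ mode ∷ y ∷ ρ) ≡ term-mode ∷ headᵗ y ∷ ρ
    ⟦goLeft⟧ l r mode y =
      cong (λ ps → term-mode ∷ headᵗ y ∷ ps) (⟦project⟧ (λ i → 4 ↑ʳ i) ρ (λ _ → refl))

    ⟦goRight⟧ : ∀ l r mode y → ⟦ goRight ⟧* (l ∷ r ∷ mode ∷ y ∷ ρ) ≡ childModeᵗ mode ∷ tailᵗ y ∷ ρ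
    ⟦goRight⟧ l r mode y =
      cong (λ ps → childModeᵗ mode ∷ tailᵗ y ∷ ps) (⟦project⟧ (λ i → 4 ↑ʳ i) ρ (λ _ → refl))

    ⟦step⟧ : ∀ resₗ resᵣ l r mode y →
             ⟦ step ⟧ (resₗ ∷ resᵣ ∷ l ∷ r ∷ mode ∷ y ∷ ρ) ≡ stepᵗ Aᵗ Bᵗ resₗ resᵣ l r mode y
    ⟦step⟧ resₗ resᵣ l          r mode                leaf         = refl
    ⟦step⟧ resₗ resᵣ leaf       r leaf                (node l′ r′) =
      cong (λ ps → ifᵗ l′ leaf (⟦ B ⟧ (r ∷ r′ ∷ ps))) (⟦project⟧ (λ i → 8 ↑ʳ i) ρ (λ _ → refl))
    ⟦step⟧ resₗ resᵣ (node _ _) r leaf                (node l′ r′) = refl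
    ⟦step⟧ resₗ resᵣ l          r (node leaf _)       (node l′ r′) =
      cong (λ ps → ifᵗ (⟦ A ⟧ (l ∷ l′ ∷ ps)) resᵣ leaf) (⟦project⟧ (λ i → 10 ↑ʳ i) ρ (λ _ → refl))
    ⟦step⟧ resₗ resᵣ l          r (node (node _ _) _) (node l′ r′) = refl

    opaque
      unfolding walk

      ⟦walk⟧ : ∀ x y → ⟦ walk x y ⟧ ρ ≡ walkᵗ Aᵗ Bᵗ term-mode (⟦ x ⟧ ρ) (⟦ y ⟧ ρ)
      ⟦walk⟧ x y = ≡.trans
        (cong (λ ps → recᵗ ⟦ base ⟧ ⟦ goLeft ⟧* ⟦ goRight ⟧* ⟦ step ⟧ (⟦ x ⟧ ρ) (term-mode ∷ ⟦ y ⟧ ρ ∷ ps))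
              (⟦project⟧ (λ i → i) ρ (λ _ → refl)))
        (go term-mode (⟦ x ⟧ ρ) (⟦ y ⟧ ρ))
        where
        go : ∀ mode x y → recᵗ ⟦ base ⟧ ⟦ goLeft ⟧* ⟦ goRight ⟧* ⟦ step ⟧ x (mode ∷ y ∷ ρ) ≡
                          walkᵗ Aᵗ Bᵗ mode x y
        go mode leaf       y = ⟦base⟧ mode y
        go mode (node l r) y
          rewrite ⟦goLeft⟧ l r mode y | ⟦goRight⟧ l r mode y
                | go term-mode l (headᵗ y) | go (childModeᵗ mode) r (tailᵗ y)
          = ⟦step⟧ _ _ l r mode y

-- Similarity

module _ {S S′ : Signature} where

  Rel𝓕 Rel𝓥 : Set₁
  Rel𝓕 = Element (𝓕 S) → Element (𝓕 S′) → Set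
  Rel𝓥 = Element (𝓥 S) → Element (𝓥 S′) → Set

  mutual
    -- The relations are parameters because they vary: the graphs of an isomorphism give equality
    -- with `mapTerm`, other choices give the tests that are computed. The argument vectors may
    -- differ in length, which avoids transport along equations between arities.
    data Similar (A : Rel𝓕) (B : Rel𝓥) : Term S → Term S′ → Set where
      var : ∀ {x x′} → B x x′ → Similar A B (var x) (var x′)
      app : ∀ {f f′ ts ts′} → A f f′ → Similars A B ts ts′ → Similar A B (app f ts) (app f′ ts′)

    data Similars (A : Rel𝓕) (B : Rel𝓥) : ∀ {m n} → Vec (Term S) m → Vec (Term S′) n → Set where
      []  : Similars A B [] []
      _∷_ : ∀ {m n t t′} {ts : Vec _ m} {ts′ : Vec _ n} →
            Similar A B t t′ → Similars A B ts ts′ → Similars A B (t ∷ ts) (t′ ∷ ts′)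

  SimilarPair : Rel𝓕 → Rel𝓥 → TermPair S → TermPair S′ → Set
  SimilarPair A B (ℓ , r) (ℓ′ , r′) = Similar A B ℓ ℓ′ × Similar A B r r′

  private variable
    A A′ : Rel𝓕
    B B′ : Rel𝓥

  module _ {a b : Tree → Tree → Tree}
    (dA : ∀ f f′ → Decides (A f f′) (a (encodeℕ (name (𝓕 S) f)) (encodeℕ (name (𝓕 S′) f′))))
    (dB : ∀ x x′ → Decides (B x x′) (b (encodeℕ (name (𝓥 S) x)) (encodeℕ (name (𝓥 S′) x′))))
    where
    mutual
      similar-decides : ∀ t t′ → Decides (Similar A B t t′)
                          (walkᵗ a b term-mode (encodeTerm t) (encodeTerm t′))
      similar-decides (var x)    (var x′)     = decides-⇔ (mk⇔ var λ { (var p) → p }) (dB x x′)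
      similar-decides (var _)    (app _ _)    = fails λ ()
      similar-decides (app _ _)  (var _)      = fails λ ()
      similar-decides (app f ts) (app f′ ts′) =
        decides-⇔ (mk⇔ (λ (p , q) → app p q) (λ { (app p q) → p , q }))
          (decides-∧ (dA f f′) (λ _ → similars-decides ts ts′))

      similars-decides : ∀ {m n} (ts : Vec _ m) (ts′ : Vec _ n) → Decides (Similars A B ts ts′)
                           (walkᵗ a b args-mode (encodeTerms ts) (encodeTerms ts′))
      similars-decides []       []         = holds []
      similars-decides []       (_ ∷ _)    = fails λ ()
      similars-decides (_ ∷ _)  []         = fails λ ()
      similars-decides (t ∷ ts) (t′ ∷ ts′) =
        decides-⇔ (mk⇔ (λ (p , q) → p ∷ q) (λ { (p ∷ q) → p , q }))
          (decides-∧ (similar-decides t t′) (λ _ → similars-decides ts ts′))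

  module _ (f : ∀ {x y} → A x y → A′ x y) (g : ∀ {x y} → B x y → B′ x y) where
    mutual
      similar-map : ∀ {t t′} → Similar A B t t′ → Similar A′ B′ t t′
      similar-map (var p)   = var (g p)
      similar-map (app p q) = app (f p) (similars-map q)

      similars-map : ∀ {m n} {ts : Vec _ m} {ts′ : Vec _ n} → Similars A B ts ts′ → Similars A′ B′ ts ts′
      similars-map []      = []
      similars-map (p ∷ q) = similar-map p ∷ similars-map q

  similars-length : ∀ {m n} {ts : Vec _ m} {ts′ : Vec _ n} → Similars A B ts ts′ → m ≡ n
  similars-length []      = refl
  similars-length (_ ∷ q) = cong suc (similars-length q)

  mutual
    -- The traversal never compares arities. They agree because the argument vectors have equal
    -- lengths, and `extend` needs this for the colours of function symbols.
    similar-arity : ∀ {t t′} → Similar A B t t′ →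
                    Similar (λ f f′ → A f f′ × ar S f ≡ ar S′ f′) B t t′
    similar-arity (var p)   = var p
    similar-arity (app p q) = app (p , similars-length q) (similars-arity q)

    similars-arity : ∀ {m n} {ts : Vec _ m} {ts′ : Vec _ n} → Similars A B ts ts′ →
                     Similars (λ f f′ → A f f′ × ar S f ≡ ar S′ f′) B ts ts′
    similars-arity []      = []
    similars-arity (p ∷ q) = similar-arity p ∷ similars-arity q

  -- The pairs of symbols at corresponding positions of two terms of the
  -- same shape.
  record Occurrences (P : Rel𝓕 → Rel𝓥 → Set) : Set₁ where
    constructor occurrences
    field
      fs     : List (Element (𝓕 S) × Element (𝓕 S′))
      xs     : List (Element (𝓥 S) × Element (𝓥 S′))
      equiv  : ∀ A B → P A B ⇔ (All (λ (f , f′) → A f f′) fs × All (λ (x , x′) → B x x′) xs)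

  occurrences-× : ∀ {P Q : Rel𝓕 → Rel𝓥 → Set} → Occurrences P → Occurrences Q →
                  Occurrences (λ A B → P A B × Q A B)
  occurrences-× (occurrences fs xs e) (occurrences fs′ xs′ e′) = occurrences (fs ++ fs′) (xs ++ xs′)
    λ A B → mk⇔
      (λ (p , q) → let a , b = Equivalence.to (e A B) p ; a′ , b′ = Equivalence.to (e′ A B) q
                   in All.++⁺ a a′ , All.++⁺ b b′)
      (λ (a , b) → Equivalence.from (e A B) (All.++⁻ˡ fs a , All.++⁻ˡ xs b) ,
                   Equivalence.from (e′ A B) (All.++⁻ʳ fs a , All.++⁻ʳ xs b))

  mutual
    -- The given similarity supplies only the shape. As `equiv` holds for all relations, one list of
    -- pairs translates the hypothesis (`Match𝓕`, `Match𝓥`), the coherence conditions inside it, and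
    -- the conclusion (the graphs of an isomorphism).
    similar-occurrences : ∀ {t t′} → Similar A B t t′ → Occurrences (λ A B → Similar A B t t′)
    similar-occurrences (var {x} {x′} _) = occurrences [] ((x , x′) ∷ [])
      λ A B → mk⇔ (λ { (var p) → [] , p ∷ [] }) (λ { (_ , p ∷ []) → var p })
    similar-occurrences (app {f} {f′} _ q) with similars-occurrences q
    ... | occurrences fs xs e = occurrences ((f , f′) ∷ fs) xs
      λ A B → mk⇔ (λ { (app p q) → let a , b = Equivalence.to (e A B) q in p ∷ a , b })
                  (λ { (p ∷ a , b) → app p (Equivalence.from (e A B) (a , b)) })

    similars-occurrences : ∀ {m n} {ts : Vec _ m} {ts′ : Vec _ n} → Similars A B ts ts′ →
                           Occurrences (λ A B → Similars A B ts ts′)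
    similars-occurrences []      = occurrences [] [] λ A B → mk⇔ (λ _ → [] , []) (λ _ → [])
    similars-occurrences (p ∷ q) with occurrences-× (similar-occurrences p) (similars-occurrences q)
    ... | occurrences fs xs e = occurrences fs xs
      λ A B → mk⇔ (λ { (p ∷ q) → Equivalence.to (e A B) (p , q) })
                  (λ ab → let p , q = Equivalence.from (e A B) ab in p ∷ q)

  module _ (φ : TermIso S S′) where

    Graph𝓕 : Rel𝓕
    Graph𝓕 f f′ = Bijection.to (φ𝓕 φ) f ≡ f′

    Graph𝓥 : Rel𝓥
    Graph𝓥 x x′ = Bijection.to (φ𝓥 φ) x ≡ x′

    mutual
      similar⇒mapTerm : ∀ {t t′} → Similar Graph𝓕 Graph𝓥 t t′ → mapTerm φ t ≡ t′
      similar⇒mapTerm (var refl)       = refl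
      similar⇒mapTerm (app {f} refl q) = cong (app _) (similars⇒mapTerms (sym (ar-φ𝓕 φ f)) q)

      -- Stated for an arbitrary length equation so that the induction passes under `Vec.cast`.
      similars⇒mapTerms : ∀ {m n} {ts : Vec _ m} {ts′ : Vec _ n} .(eq : m ≡ n) →
                          Similars Graph𝓕 Graph𝓥 ts ts′ → Vec.cast eq (mapTerms φ ts) ≡ ts′
      similars⇒mapTerms eq []      = refl
      similars⇒mapTerms eq (p ∷ q) = cong₂ _∷_ (similar⇒mapTerm p) (similars⇒mapTerms _ q)

    mutual
      similar-mapTerm : ∀ t → Similar Graph𝓕 Graph𝓥 t (mapTerm φ t)
      similar-mapTerm (var x)    = var refl
      similar-mapTerm (app f ts) = app refl (similars-mapTerms (sym (ar-φ𝓕 φ f)) ts)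

      similars-mapTerms : ∀ {m n} .(eq : m ≡ n) (ts : Vec _ m) →
                          Similars Graph𝓕 Graph𝓥 ts (Vec.cast eq (mapTerms φ ts))
      similars-mapTerms {n = zero}  eq []       = []
      similars-mapTerms {n = suc n} eq (t ∷ ts) = similar-mapTerm t ∷ similars-mapTerms _ ts

    similarPair⇔mapPair : ∀ {ρ ρ′} → SimilarPair Graph𝓕 Graph𝓥 ρ ρ′ ⇔ mapPair φ ρ ≡ ρ′
    similarPair⇔mapPair = mk⇔
      (λ (p , q) → cong₂ _,_ (similar⇒mapTerm p) (similar⇒mapTerm q))
      (λ { refl → similar-mapTerm _ , similar-mapTerm _ })

module _ {S S₁ S₂ : Signature}
         {A₁ : Rel𝓕 {S} {S₁}} {B₁ : Rel𝓥 {S} {S₁}} {A₂ : Rel𝓕 {S} {S₂}} {B₂ : Rel𝓥 {S} {S₂}}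
         {A : Rel𝓕 {S₁} {S₂}} {B : Rel𝓥 {S₁} {S₂}}
         (f : ∀ {x x₁ x₂} → A₁ x x₁ → A₂ x x₂ → A x₁ x₂)
         (g : ∀ {x x₁ x₂} → B₁ x x₁ → B₂ x x₂ → B x₁ x₂) where
  mutual
    similar-span : ∀ {t t₁ t₂} → Similar {S} {S₁} A₁ B₁ t t₁ → Similar {S} {S₂} A₂ B₂ t t₂ →
                   Similar {S₁} {S₂} A B t₁ t₂
    similar-span (var p)   (var p′)    = var (g p p′)
    similar-span (app p q) (app p′ q′) = app (f p p′) (similars-span q q′)

    similars-span : ∀ {m m₁ m₂} {ts : Vec _ m} {ts₁ : Vec _ m₁} {ts₂ : Vec _ m₂} →
                    Similars {S} {S₁} A₁ B₁ ts ts₁ → Similars {S} {S₂} A₂ B₂ ts ts₂ →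
                    Similars {S₁} {S₂} A B ts₁ ts₂
    similars-span []      []        = []
    similars-span (p ∷ q) (p′ ∷ q′) = similar-span p p′ ∷ similars-span q q′

-- Isomorphism of rules

encodeℕᵇ-injective : ∀ {x y} → encodeℕᵇ x ≡ encodeℕᵇ y → x ≡ y
encodeℕᵇ-injective {ℕᵇ.zero} {ℕᵇ.zero} _  = refl
encodeℕᵇ-injective {2[1+ x ]} {2[1+ y ]} eq = cong 2[1+_] (encodeℕᵇ-injective (cong tailᵗ eq))
encodeℕᵇ-injective {1+[2 x ]} {1+[2 y ]} eq = cong 1+[2_] (encodeℕᵇ-injective (cong tailᵗ eq))
encodeℕᵇ-injective {2[1+ x ]} {1+[2 y ]} ()
encodeℕᵇ-injective {1+[2 x ]} {2[1+ y ]} ()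

encodeℕ-injective : ∀ {m n} → encodeℕ m ≡ encodeℕ n → m ≡ n
encodeℕ-injective eq = fromℕ-injective (encodeℕᵇ-injective eq)

module _ {S : Signature} where
  mutual
    encodeTerm-injective : ∀ {s t : Term S} → encodeTerm s ≡ encodeTerm t → s ≡ t
    encodeTerm-injective {var x}    {var y}    eq =
      cong var (name-injective (𝓥 S) (encodeℕ-injective (cong tailᵗ eq)))
    encodeTerm-injective {app f ss} {app g ts} eq
      with refl ← name-injective (𝓕 S) (encodeℕ-injective (cong (headᵗ ∘ tailᵗ) eq))
      = cong (app f) (encodeTerms-injective (cong (tailᵗ ∘ tailᵗ) eq))

    encodeTerms-injective : ∀ {n} {ss ts : Vec (Term S) n} → encodeTerms ss ≡ encodeTerms ts → ss ≡ ts
    encodeTerms-injective {ss = []}     {[]}     _  = refl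
    encodeTerms-injective {ss = s ∷ ss} {t ∷ ts} eq =
      cong₂ _∷_ (encodeTerm-injective (cong headᵗ eq)) (encodeTerms-injective (cong tailᵗ eq))

  encodePair-injective : ∀ {p q : TermPair S} → encodePair p ≡ encodePair q → p ≡ q
  encodePair-injective eq =
    cong₂ _,_ (encodeTerm-injective (cong headᵗ eq)) (encodeTerm-injective (cong tailᵗ eq))

  encodePair-decides : ∀ (p q : TermPair S) → Decides (p ≡ q) (eqᵗ (encodePair p) (encodePair q))
  encodePair-decides p q = decides-⇔ (mk⇔ encodePair-injective (cong encodePair)) (eq-decides _ _)

name-decides : ∀ (X Y : FiniteSet) (x : Element X) (y : Element Y) →
               Decides (name X x ≡ name Y y) (eqᵗ (encodeℕ (name X x)) (encodeℕ (name Y y)))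
name-decides X Y x y = decides-⇔ (mk⇔ encodeℕ-injective (cong encodeℕ)) (eq-decides _ _)

element-decides : ∀ (X : FiniteSet) (x y : Element X) →
                  Decides (x ≡ y) (eqᵗ (encodeℕ (name X x)) (encodeℕ (name X y)))
element-decides X x y = decides-⇔ (mk⇔ (name-injective X) (cong (name X))) (name-decides X X x y)

decides-→ : Decides P t₁ → (P → Decides Q t₂) → Decides (P → Q) (ifᵗ t₁ t₂ trueᵗ)
decides-→ (fails ¬p) d = holds (λ p → ⊥-elim (¬p p))
decides-→ (holds p)  d with d p
... | holds q  = holds (λ _ → q)
... | fails ¬q = fails (λ f → ¬q (f p))

decides-iff : Decides P t₁ → Decides Q t₂ → Decides (P ⇔ Q) (ifᵗ t₁ t₂ (ifᵗ t₂ leaf trueᵗ))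
decides-iff (holds p)  (holds q)  = holds (mk⇔ (λ _ → q) (λ _ → p))
decides-iff (holds p)  (fails ¬q) = fails (λ e → ¬q (Equivalence.to e p))
decides-iff (fails ¬p) (holds q)  = fails (λ e → ¬p (Equivalence.from e q))
decides-iff (fails ¬p) (fails ¬q) = holds (mk⇔ (λ p → ⊥-elim (¬p p)) (λ q → ⊥-elim (¬q q)))

when : Bool → Code n → Code n
when Bool.true  c = c
when Bool.false c = true

when-decides : ∀ b (c : Code n) ρ → Decides P (⟦ c ⟧ ρ) →
               Decides (b ≡ Bool.true → P) (⟦ when b c ⟧ ρ)
when-decides Bool.true  c ρ d = decides-⇔ (mk⇔ (λ p _ → p) (λ f → f refl)) d
when-decides Bool.false c ρ d = holds λ ()

walkPair : (A B : Code (2 + n)) → Code n → Code n → Code n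
walkPair A B x y = walk A B (headᶜ x) (headᶜ y) ∧ walk A B (tailᶜ x) (tailᶜ y)

walkPair-decides : ∀ {S S′} {A : Rel𝓕 {S} {S′}} {B : Rel𝓥 {S} {S′}} (Aᶜ Bᶜ : Code (2 + n)) x y ρ →
  (p : TermPair S) (q : TermPair S′) → ⟦ x ⟧ ρ ≡ encodePair p → ⟦ y ⟧ ρ ≡ encodePair q →
  (∀ f f′ → Decides (A f f′) (⟦ Aᶜ ⟧ (encodeℕ (name (𝓕 S) f) ∷ encodeℕ (name (𝓕 S′) f′) ∷ ρ))) →
  (∀ z z′ → Decides (B z z′) (⟦ Bᶜ ⟧ (encodeℕ (name (𝓥 S) z) ∷ encodeℕ (name (𝓥 S′) z′) ∷ ρ))) →
  Decides (SimilarPair A B p q) (⟦ walkPair Aᶜ Bᶜ x y ⟧ ρ)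
walkPair-decides {S = S} {S′} Aᶜ Bᶜ x y ρ (ℓ , r) (ℓ′ , r′) eqx eqy dA dB = decides-∧
  (subst (Decides _) (sym (≡.trans (⟦walk⟧ Aᶜ Bᶜ ρ (headᶜ x) (headᶜ y))
      (cong₂ (λ a b → walkᵗ (Aᵗ Aᶜ Bᶜ ρ) (Bᵗ Aᶜ Bᶜ ρ) term-mode (headᵗ a) (headᵗ b)) eqx eqy)))
    (similar-decides dA dB ℓ ℓ′))
  (λ _ → subst (Decides _) (sym (≡.trans (⟦walk⟧ Aᶜ Bᶜ ρ (tailᶜ x) (tailᶜ y))
      (cong₂ (λ a b → walkᵗ (Aᵗ Aᶜ Bᶜ ρ) (Bᵗ Aᶜ Bᶜ ρ) term-mode (tailᵗ a) (tailᵗ b)) eqx eqy)))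
    (similar-decides dA dB r r′))

coherent : Code 6
coherent = if (v2 == v0) (v3 == v1) (not (v3 == v1))

module _ (b𝓕 b𝓥 : Bool) where

  -- The inner traversal compares the pair of symbols at one position (`v0`, `v1`, which are `v2`,
  -- `v3` inside `coherent`) with the pairs at all positions. Symbols of the other sort are accepted
  -- there by `true`.
  match𝓕 match𝓥 : Code 4
  match𝓕 = when b𝓕 (v0 == v1) ∧ walkPair coherent true v2 v3
  match𝓥 = when b𝓥 (v0 == v1) ∧ walkPair true coherent v2 v3

  opaque
    match : Code 2
    match = walkPair match𝓕 match𝓥 v0 v1

  module _ {S S′ : Signature} (p : TermPair S) (q : TermPair S′) where

    Match𝓕 : Rel𝓕 {S} {S′}
    Match𝓕 f f′ = (b𝓕 ≡ Bool.true → name (𝓕 S) f ≡ name (𝓕 S′) f′) ×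
                  SimilarPair (λ g g′ → f ≡ g ⇔ f′ ≡ g′) (λ _ _ → ⊤) p q

    Match𝓥 : Rel𝓥 {S} {S′}
    Match𝓥 x x′ = (b𝓥 ≡ Bool.true → name (𝓥 S) x ≡ name (𝓥 S′) x′) ×
                  SimilarPair (λ _ _ → ⊤) (λ y y′ → x ≡ y ⇔ x′ ≡ y′) p q

    opaque
      unfolding match

      match-decides : Decides (SimilarPair Match𝓕 Match𝓥 p q)
                              (⟦ match ⟧ (encodePair p ∷ encodePair q ∷ []))
      match-decides = walkPair-decides match𝓕 match𝓥 v0 v1 ρ₀ p q refl refl
        (λ f f′ → let ρ = encodeℕ (name (𝓕 S) f) ∷ encodeℕ (name (𝓕 S′) f′) ∷ ρ₀ in
          decides-∧ (when-decides b𝓕 (v0 == v1) ρ (name-decides (𝓕 S) (𝓕 S′) f f′))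
            (λ _ → walkPair-decides coherent true v2 v3 ρ p q refl refl
              (λ g g′ → decides-iff (element-decides (𝓕 S) f g) (element-decides (𝓕 S′) f′ g′))
              (λ _ _ → holds _)))
        (λ x x′ → let ρ = encodeℕ (name (𝓥 S) x) ∷ encodeℕ (name (𝓥 S′) x′) ∷ ρ₀ in
          decides-∧ (when-decides b𝓥 (v0 == v1) ρ (name-decides (𝓥 S) (𝓥 S′) x x′))
            (λ _ → walkPair-decides true coherent v2 v3 ρ p q refl refl
              (λ _ _ → holds _)
              (λ y y′ → decides-iff (element-decides (𝓥 S) x y) (element-decides (𝓥 S′) x′ y′))))
        where
        ρ₀ : Vec Tree 2
        ρ₀ = encodePair p ∷ encodePair q ∷ []

entry𝓕 : ∀ S → Element (𝓕 S) → Tree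
entry𝓕 S f = node (encodeℕ (name (𝓕 S) f)) (encodeℕ (ar S f))

entry𝓥 : ∀ S → Element (𝓥 S) → Tree
entry𝓥 S x = encodeℕ (name (𝓥 S) x)

-- A key holds what bijections must preserve: the whole entry if names are to be fixed; otherwise
-- the arity of a function symbol, and for variables a constant, so that only their number counts.
key𝓕 key𝓥 : Bool → Code 1
key𝓕 Bool.true  = v0
key𝓕 Bool.false = tailᶜ v0
key𝓥 Bool.true  = v0
key𝓥 Bool.false = false

colour𝓕 : Bool → ∀ S → Element (𝓕 S) → Tree
colour𝓕 b S f = key (key𝓕 b) (entry𝓕 S f)

colour𝓥 : Bool → ∀ S → Element (𝓥 S) → Tree
colour𝓥 b S x = key (key𝓥 b) (entry𝓥 S x)

colour𝓕-⇔ : ∀ b S S′ f f′ → colour𝓕 b S′ f′ ≡ colour𝓕 b S f ⇔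
  ((b ≡ Bool.true → name (𝓕 S′) f′ ≡ name (𝓕 S) f) × ar S′ f′ ≡ ar S f)
colour𝓕-⇔ Bool.true S S′ f f′ = mk⇔
  (λ eq → (λ _ → encodeℕ-injective (cong headᵗ eq)) , encodeℕ-injective (cong tailᵗ eq))
  (λ (eq , eq′) → cong₂ (λ a b → node (encodeℕ a) (encodeℕ b)) (eq refl) eq′)
colour𝓕-⇔ Bool.false S S′ f f′ = mk⇔
  (λ eq → (λ ()) , encodeℕ-injective eq) (λ (_ , eq) → cong encodeℕ eq)

colour𝓥-⇔ : ∀ b S S′ x x′ → colour𝓥 b S′ x′ ≡ colour𝓥 b S x ⇔
  (b ≡ Bool.true → name (𝓥 S′) x′ ≡ name (𝓥 S) x)
colour𝓥-⇔ Bool.true  S S′ x x′ = mk⇔ (λ eq _ → encodeℕ-injective eq) (λ eq → cong encodeℕ (eq refl))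
colour𝓥-⇔ Bool.false S S′ x x′ = mk⇔ (λ _ ()) (λ _ → refl)

sameColours-decides : ∀ (keyᶜ : Code 1) {m n} (e : Fin m → Tree) (e′ : Fin n → Tree) →
  Decides (Σ[ g ∈ Fin m ⤖ Fin n ] Preserves (key keyᶜ ∘ e) (key keyᶜ ∘ e′) g)
          (⟦ sameKeys keyᶜ ⟧ (encodeList (List.tabulate e) ∷ encodeList (List.tabulate e′) ∷ []))
sameColours-decides keyᶜ e e′ = decides-⇔
  (mk⇔ (λ p → ↭⇒bijection _ _ (≡.subst₂ _↭_ eq eq′ p))
       (λ g → ≡.subst₂ _↭_ (sym eq) (sym eq′) (bijection⇒↭ _ _ g)))
  (sameKeys-decides keyᶜ (List.tabulate e) (List.tabulate e′))
  where
  eq = List.map-tabulate e (key keyᶜ)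
  eq′ = List.map-tabulate e′ (key keyᶜ)

module Isomorphism (b𝓕 b𝓥 : Bool) where

  Class : IsoClass
  Class φ = (b𝓕 ≡ Bool.true → 𝓕-Invariant φ) × (b𝓥 ≡ Bool.true → 𝓥-Invariant φ)

  opaque
    -- A term isomorphism is defined on the whole signature, including symbols absent from the rule;
    -- hence the first two tests.
    iso : Code 4
    iso = call′ (sameKeys (key𝓕 b𝓕)) (headᶜ v0 ∷ headᶜ v1 ∷ []) ∧
          call′ (sameKeys (key𝓥 b𝓥)) (headᶜ (tailᶜ v0) ∷ headᶜ (tailᶜ v1) ∷ []) ∧
          call′ (match b𝓕 b𝓥) (v2 ∷ v3 ∷ [])

  module _ {S S′ : Signature} {p : TermPair S} {q : TermPair S′} where

    private
      Bijections : Set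
      Bijections = (∃[ g ] Preserves (colour𝓕 b𝓕 S) (colour𝓕 b𝓕 S′) g) ×
                   (∃[ g ] Preserves (colour𝓥 b𝓥 S) (colour𝓥 b𝓥 S′) g)

    match⇒iso : Bijections → SimilarPair (Match𝓕 b𝓕 b𝓥 p q) (Match𝓥 b𝓕 b𝓥 p q) p q →
                Σ[ φ ∈ TermIso S S′ ] Class φ × mapPair φ p ≡ q
    match⇒iso (g𝓕 , g𝓥) (s , s′) =
      φ ,
      ((λ b≡ f → proj₁ (Equivalence.to (colour𝓕-⇔ b𝓕 S S′ f _) (proj₁ (proj₂ h𝓕) f)) b≡) ,
       (λ b≡ x → Equivalence.to (colour𝓥-⇔ b𝓥 S S′ x _) (proj₁ (proj₂ h𝓥) x) b≡)) ,
      Equivalence.to (similarPair⇔mapPair φ)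
        (Equivalence.from (equiv _ _) (proj₂ (proj₂ h𝓕) , proj₂ (proj₂ h𝓥)))
      where
      open Occurrences (occurrences-× (similar-occurrences s) (similar-occurrences s′))

      matches = Equivalence.to (equiv _ _) (similar-arity s , similar-arity s′)

      -- Each pair in `fs` comes with a similarity of the two rules for its own coherence relation;
      -- `equiv` turns this into coherence with every pair of `fs`.
      h𝓕 = extend (colour𝓕 b𝓕 S) (colour𝓕 b𝓕 S′) g𝓕 fs
        (All.map (λ ((_ , c) , _) → proj₁ (Equivalence.to (equiv _ _) c)) (proj₁ matches))
        (All.map (λ ((e , _) , a) →
          Equivalence.from (colour𝓕-⇔ b𝓕 S S′ _ _) ((λ b≡ → sym (e b≡)) , sym a)) (proj₁ matches))

      h𝓥 = extend (colour𝓥 b𝓥 S) (colour𝓥 b𝓥 S′) g𝓥 xs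
        (All.map (λ (_ , c) → proj₂ (Equivalence.to (equiv _ _) c)) (proj₂ matches))
        (All.map (λ (e , _) →
          Equivalence.from (colour𝓥-⇔ b𝓥 S S′ _ _) (λ b≡ → sym (e b≡))) (proj₂ matches))

      φ : TermIso S S′
      φ = record
        { φ𝓕    = proj₁ h𝓕
        ; φ𝓥    = proj₁ h𝓥
        ; ar-φ𝓕 = λ f → proj₂ (Equivalence.to (colour𝓕-⇔ b𝓕 S S′ f _) (proj₁ (proj₂ h𝓕) f))
        }

    iso⇒match : (φ : TermIso S S′) → Class φ → mapPair φ p ≡ q →
                Bijections × SimilarPair (Match𝓕 b𝓕 b𝓥 p q) (Match𝓥 b𝓕 b𝓥 p q) p q
    iso⇒match φ (inv𝓕 , inv𝓥) eq =
      ((φ𝓕 φ , λ f → Equivalence.from (colour𝓕-⇔ b𝓕 S S′ f _) ((λ b≡ → inv𝓕 b≡ f) , ar-φ𝓕 φ f)) ,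
       (φ𝓥 φ , λ x → Equivalence.from (colour𝓥-⇔ b𝓥 S S′ x _) (λ b≡ → inv𝓥 b≡ x))) ,
      mapPairs
        (λ { {f} refl → (λ b≡ → sym (inv𝓕 b≡ f)) ,
               mapPairs (λ { refl → mk⇔ (cong _) (Bijection.injective (φ𝓕 φ)) }) (λ _ → tt) graph })
        (λ { {x} refl → (λ b≡ → sym (inv𝓥 b≡ x)) ,
               mapPairs (λ _ → tt) (λ { refl → mk⇔ (cong _) (Bijection.injective (φ𝓥 φ)) }) graph })
        graph
      where
      graph : SimilarPair (Graph𝓕 φ) (Graph𝓥 φ) p q
      graph = Equivalence.from (similarPair⇔mapPair φ) eq

      mapPairs : ∀ {A B} → (∀ {f f′} → Graph𝓕 φ f f′ → A f f′) →
                 (∀ {x x′} → Graph𝓥 φ x x′ → B x x′) →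
                 SimilarPair (Graph𝓕 φ) (Graph𝓥 φ) p q → SimilarPair A B p q
      mapPairs f g (s , s′) = similar-map f g s , similar-map f g s′

  module _ (R R′ : TRS) (p : TermPair (signature R)) (q : TermPair (signature R′)) where

    opaque
      unfolding iso

      iso-decides : Decides (Σ[ φ ∈ TermIso (signature R) (signature R′) ] Class φ × mapPair φ p ≡ q)
        (⟦ iso ⟧ (encodeTRS R ∷ encodeTRS R′ ∷ encodePair p ∷ encodePair q ∷ []))
      iso-decides = decides-⇔
        (mk⇔ (λ w → match⇒iso (proj₁ w , proj₁ (proj₂ w)) (proj₂ (proj₂ w)))
             (λ (φ , c , eq) → let (g , h) , s = iso⇒match φ c eq in g , h , s))
        (decides-∧ (sameColours-decides (key𝓕 b𝓕) (entry𝓕 (signature R)) (entry𝓕 (signature R′)))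
          (λ _ → decides-∧ (sameColours-decides (key𝓥 b𝓥) (entry𝓥 (signature R)) (entry𝓥 (signature R′)))
            (λ _ → match-decides b𝓕 b𝓥 p q)))

-- Isomorphism of systems

rulesᶜ : ∀ {n} → Code n → Code n
rulesᶜ c = tailᶜ (tailᶜ c)

module LocalIsomorphism (b𝓕 b𝓥 : Bool) (C : IsoClass)
  (C⇔Class : ∀ {S S′} (φ : TermIso S S′) → C φ ⇔ Isomorphism.Class b𝓕 b𝓥 φ) where
  open Isomorphism b𝓕 b𝓥

  Equiv : ∀ {S S′} → TermPair S → TermPair S′ → Set
  Equiv {S} {S′} p q = Σ[ φ ∈ TermIso S S′ ] C φ × mapPair φ p ≡ q

  equiv-decides : ∀ R R′ (p : TermPair (signature R)) (q : TermPair (signature R′)) →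
    Decides (Equiv p q) (⟦ iso ⟧ (encodeTRS R ∷ encodeTRS R′ ∷ encodePair p ∷ encodePair q ∷ []))
  equiv-decides R R′ p q = decides-⇔
    (mk⇔ (λ (φ , c , eq) → φ , Equivalence.from (C⇔Class φ) c , eq)
         (λ (φ , c , eq) → φ , Equivalence.to (C⇔Class φ) c , eq))
    (iso-decides R R′ p q)

  -- The witness is `φ₂` after the inverse of `φ₁`. It serves to identify two rules of a normal form
  -- that are related to the same rule.
  equiv-span : ∀ {S S₁ S₂} {p : TermPair S} {q₁ : TermPair S₁} {q₂ : TermPair S₂} →
               Equiv p q₁ → Equiv p q₂ → Equiv q₁ q₂
  equiv-span {S} {S₁} {S₂} {p} {q₁} {q₂} (φ₁ , c₁ , eq₁) (φ₂ , c₂ , eq₂) =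
    ψ , Equivalence.from (C⇔Class ψ) class , Equivalence.to (similarPair⇔mapPair ψ) graph
    where
    inverse : ∀ {A B D : Set} (g₁ : A ⤖ B) (g₂ : A ⤖ D) {a b d} →
              Bijection.to g₁ a ≡ b → Bijection.to g₂ a ≡ d →
              Bijection.to (g₂ ⤖-∘ ⤖-sym g₁) b ≡ d
    inverse g₁ g₂ refl refl = cong (Bijection.to g₂)
      (Bijection.injective g₁ (proj₂ (Bijection.strictlySurjective g₁ _)))

    along : ∀ {A B D X : Set} (g₁ : A ⤖ B) (g₂ : A ⤖ D) (α : A → X) (β : B → X) (δ : D → X) →
            (∀ a → β (Bijection.to g₁ a) ≡ α a) → (∀ a → δ (Bijection.to g₂ a) ≡ α a) →
            ∀ b → δ (Bijection.to (g₂ ⤖-∘ ⤖-sym g₁) b) ≡ β b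
    along g₁ g₂ α β δ e₁ e₂ b =
      ≡.trans (e₂ _) (≡.trans (sym (e₁ _)) (cong β (proj₂ (Bijection.strictlySurjective g₁ b))))

    ψ : TermIso S₁ S₂
    ψ = record
      { φ𝓕    = φ𝓕 φ₂ ⤖-∘ ⤖-sym (φ𝓕 φ₁)
      ; φ𝓥    = φ𝓥 φ₂ ⤖-∘ ⤖-sym (φ𝓥 φ₁)
      ; ar-φ𝓕 = along (φ𝓕 φ₁) (φ𝓕 φ₂) (ar S) (ar S₁) (ar S₂) (ar-φ𝓕 φ₁) (ar-φ𝓕 φ₂)
      }

    class₁ = Equivalence.to (C⇔Class φ₁) c₁
    class₂ = Equivalence.to (C⇔Class φ₂) c₂

    class : Class ψ
    class =
      (λ b≡ → along (φ𝓕 φ₁) (φ𝓕 φ₂) (name (𝓕 S)) (name (𝓕 S₁)) (name (𝓕 S₂))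
                    (proj₁ class₁ b≡) (proj₁ class₂ b≡)) ,
      (λ b≡ → along (φ𝓥 φ₁) (φ𝓥 φ₂) (name (𝓥 S)) (name (𝓥 S₁)) (name (𝓥 S₂))
                    (proj₂ class₁ b≡) (proj₂ class₂ b≡))

    graph : SimilarPair (Graph𝓕 ψ) (Graph𝓥 ψ) q₁ q₂
    graph =
      let s₁ , s₁′ = Equivalence.from (similarPair⇔mapPair φ₁) eq₁
          s₂ , s₂′ = Equivalence.from (similarPair⇔mapPair φ₂) eq₂
      in similar-span (inverse (φ𝓕 φ₁) (φ𝓕 φ₂)) (inverse (φ𝓥 φ₁) (φ𝓥 φ₂)) s₁ s₂ ,
         similar-span (inverse (φ𝓕 φ₁) (φ𝓕 φ₂)) (inverse (φ𝓥 φ₁) (φ𝓥 φ₂)) s₁′ s₂′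

  -- The contrapositive is what bounded quantifiers can test; it is equivalent because equality of
  -- rules is decidable.
  normal-⇔ : ∀ R → All (λ p → All (λ q → Equiv p q → p ≡ q) (rules R)) (rules R) ⇔ NormalFormFor C R
  normal-⇔ R = mk⇔ to from
    where
    to : All (λ p → All (λ q → Equiv p q → p ≡ q) (rules R)) (rules R) → NormalFormFor C R
    to h p∈ q∈ p≢q e = p≢q (All.lookup (All.lookup h p∈) q∈ e)

    from : NormalFormFor C R → All (λ p → All (λ q → Equiv p q → p ≡ q) (rules R)) (rules R)
    from nf = All.tabulate λ {p} p∈ → All.tabulate λ {q} q∈ e →
      decidable-stable (decides⇒dec (encodePair-decides p q)) (λ p≢q → nf p∈ q∈ p≢q e)

  localIso-⇔ : ∀ R R′ → NormalFormFor C R′ →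
    (All (λ p → Any (λ q → Equiv p q) (rules R′)) (rules R) ×
     All (λ q → Any (λ p → Equiv p q) (rules R)) (rules R′)) ⇔ LocalIso C R R′
  localIso-⇔ R R′ nf = mk⇔ to from
    where
    to : All (λ p → Any (λ q → Equiv p q) (rules R′)) (rules R) ×
         All (λ q → Any (λ p → Equiv p q) (rules R)) (rules R′) → LocalIso C R R′
    to (forth , back) = (λ i → proj₁ (image-equiv i)) , (λ i → proj₁ (proj₂ (image-equiv i))) ,
      λ q → mk⇔ (λ (i , eq) → subst (_∈ rules R′)
                  (≡.trans (sym (proj₂ (proj₂ (image-equiv i)))) eq) (image-∈ i))
                (λ q∈ → let i , i↦q = reached q∈ in i , ≡.trans (proj₂ (proj₂ (image-equiv i))) i↦q)
      where
      rule : Fin (length (rules R)) → TermPair (signature R)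
      rule = List.lookup (rules R)

      image : ∀ i → ∃[ q ] q ∈ rules R′ × Equiv (rule i) q
      image i = find (All.lookup forth (∈-lookup i))

      image-∈ : ∀ i → proj₁ (image i) ∈ rules R′
      image-∈ i = proj₁ (proj₂ (image i))

      image-equiv : ∀ i → Equiv (rule i) (proj₁ (image i))
      image-equiv i = proj₂ (proj₂ (image i))

      reached : ∀ {q} → q ∈ rules R′ → ∃[ i ] proj₁ (image i) ≡ q
      -- The image chosen for the rule related to `q` might not be `q`. But both are related to that
      -- rule, hence to each other, and normal form makes them equal.
      reached q∈ with find (All.lookup back q∈)
      ... | p , p∈ , e = i , All.lookup (All.lookup (Equivalence.from (normal-⇔ R′) nf) (image-∈ i)) q∈
          (equiv-span (image-equiv i) (subst (λ p → Equiv p _) (Any.lookup-index p∈) e))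
        where i = Any.index p∈

    from : LocalIso C R R′ → _
    from (φ , c , covers) =
      All.tabulate (λ p∈ → let i = Any.index p∈ ; q = mapPair (φ i) (List.lookup (rules R) i) in
        lose (Equivalence.to (covers q) (i , refl))
             (subst (λ p → Equiv p q) (sym (Any.lookup-index p∈)) (φ i , c i , refl))) ,
      All.tabulate (λ q∈ → let i , eq = Equivalence.from (covers _) q∈ in
        lose (∈-lookup i) (φ i , c i , eq))

  equalIfEquiv : Code 3
  equalIfEquiv = if (call′ iso (v2 ∷ v2 ∷ v1 ∷ v0 ∷ [])) (v1 == v0) true

  opaque
    normal : Code 1
    normal = all (rulesᶜ v0) (all (rulesᶜ v1) equalIfEquiv)

  opaque
    locallyIsomorphic : Code 2
    locallyIsomorphic = call′ normal (v0 ∷ []) ∧ call′ normal (v1 ∷ []) ∧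
      all (rulesᶜ v0) (any (rulesᶜ v2) (call′ iso (v2 ∷ v3 ∷ v1 ∷ v0 ∷ []))) ∧
      all (rulesᶜ v1) (any (rulesᶜ v1) (call′ iso (v2 ∷ v3 ∷ v0 ∷ v1 ∷ [])))

  opaque
    unfolding normal

    normal-decides : ∀ R → Decides (NormalFormFor C R) (⟦ normal ⟧ (encodeTRS R ∷ []))
    normal-decides R = decides-⇔ (normal-⇔ R)
      (all-decides encodePair (rules R) (rulesᶜ v0) (all (rulesᶜ v1) equalIfEquiv) (encodeTRS R ∷ []) refl λ p →
        all-decides encodePair (rules R) (rulesᶜ v1) equalIfEquiv (encodePair p ∷ encodeTRS R ∷ []) refl λ q →
          decides-→ (equiv-decides R R p q) (λ _ → encodePair-decides p q))

  opaque
    unfolding locallyIsomorphic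

    locallyIsomorphic-decides : ∀ R R′ →
      Decides (NormalFormFor C R × NormalFormFor C R′ × LocalIso C R R′)
      (⟦ locallyIsomorphic ⟧ (encodeTRS R ∷ encodeTRS R′ ∷ []))
    locallyIsomorphic-decides R R′ =
      decides-∧ (normal-decides R) λ _ → decides-∧ (normal-decides R′) λ nf →
        decides-⇔ (localIso-⇔ R R′ nf)
        (decides-∧
          (all-decides encodePair (rules R) (rulesᶜ v0) _ ρ refl λ p →
            any-decides encodePair (rules R′) (rulesᶜ v2) _ (encodePair p ∷ ρ) refl λ q →
              equiv-decides R R′ p q) λ _ →
          all-decides encodePair (rules R′) (rulesᶜ v1) _ ρ refl λ q →
            any-decides encodePair (rules R) (rulesᶜ v1) _ (encodePair q ∷ ρ) refl λ p →
              equiv-decides R R′ p q)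
      where
      ρ : Vec Tree 2
      ρ = encodeTRS R ∷ encodeTRS R′ ∷ []

  polyTimeDecidable : PolyTimeDecidable encodeTRS²
    (λ (R , R′) → NormalFormFor C R × NormalFormFor C R′ × LocalIso C R R′)
  polyTimeDecidable = decides⇒polyTimeDecidable encodeTRS²
    (call′ locallyIsomorphic (headᶜ v0 ∷ tailᶜ v0 ∷ []))
    (λ (R , R′) → locallyIsomorphic-decides R R′)

mainTheorem10 : PolyTimeDecidable encodeTRS² (λ (R₁ , R₂) → R₁ ≅LE R₂) ×
    PolyTimeDecidable encodeTRS² (λ (R₁ , R₂) → R₁ ≅LVE R₂) ×
    PolyTimeDecidable encodeTRS² (λ (R₁ , R₂) → R₁ ≅LFE R₂)
mainTheorem10 =
  -- The flags say whether function names and variable names are to be kept. The class is passed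
  -- separately because `Class` is only equivalent to the classes in the statement.
  LocalIsomorphism.polyTimeDecidable Bool.false Bool.false AnyIso
    (λ φ → mk⇔ (λ _ → (λ ()) , (λ ())) _) ,
  LocalIsomorphism.polyTimeDecidable Bool.true Bool.false 𝓕-Invariant
    (λ φ → mk⇔ (λ inv → (λ _ → inv) , (λ ())) (λ (inv , _) → inv refl)) ,
  LocalIsomorphism.polyTimeDecidable Bool.false Bool.true 𝓥-Invariant
    (λ φ → mk⇔ (λ inv → (λ ()) , (λ _ → inv)) (λ (_ , inv) → inv refl))
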